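{- Let $n\ge 3$ and $k\ge 3$. There exists a cyclic sequence over $\{0,\dots,k-1\}$ of length $L_k(n)=|\mathbf{S}_k(n)|$ whose length-$n$ windows are exactly the elements of $\mathbf{S}_k(n)$, each occurring exactly once (a universal cycle for $\mathbf{S}_k(n)$); this sequence is an orientable sequence of order $n$.
   Context: Let $\Sigma=\{0,1,\dots,k-1\}$. Strings are compared lexicographically ($\alpha<\beta$ if $\alpha$ is a proper prefix of $\beta$, or $\alpha$ has the smaller symbol at the first index where they differ). For $\alpha=a_1\cdots a_n$, $\alpha^R=a_n\cdots a_1$; $[\alpha]$ is the set of rotations of $\alpha$. $\alpha$ is a necklace if it is the lexicographically smallest element of $[\alpha]$; a bracelet if it is the lexicographically smallest element of $[\alpha]\cup[\alpha^R]$. A necklace $\alpha$ is symmetric if $\alpha^R\in[\alpha]$, asymmetric otherwise. $\mathbf{A}_k(n)$ is the set of asymmetric bracelets of length $n$ over $\Sigma$, and $\mathbf{S}_k(n)=\bigcup_{\alpha\in\mathbf{A}_k(n)}[\alpha]$. A cyclic sequence $s_1\cdots s_L$ has windows $w_t=s_t\cdots s_{t+n-1}$ ($t=1,\dots,L$, indices mod $L$); it is an orientable sequence of order $n$ if the $2L$ strings $w_1,\dots,w_L,w_1^R,\dots,w_L^R$ are pairwise distinct. -}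

module Defs where

open import Data.Fin.Base using (Fin; toℕ)
import Data.Fin.Base as Fin
import Data.Fin.Properties as Fin
open import Data.List.Base using (List; []; _∷_; length; filter; allFin; cartesianProductWith)
open import Data.List.Membership.Propositional using (_∈_; lose; find)
open import Data.List.Membership.Propositional.Properties using (∈-allFin; ∈-cartesianProductWith⁺)
import Data.List.Relation.Unary.All as All
import Data.List.Relation.Unary.AllPairs as AllPairs
open import Data.List.Relation.Unary.Any using (here; any?)
open import Data.List.Relation.Unary.Unique.Propositional using (Unique)
open import Data.List.Relation.Unary.Unique.Propositional.Properties using (allFin⁺; cartesianProductWith⁺)
open import Data.Nat.Base using (ℕ; zero; suc; _+_)
open import Data.Nat.DivMod using (_mod_)
open import Data.Product using (_×_; _,_; ∃; ∃!)
open import Data.Sum.Base using (_⊎_; [_,_]′)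
open import Data.Vec.Base using (Vec; []; _∷_; lookup; tabulate; reverse)
import Data.Vec.Properties as Vec
open import Data.Vec.Relation.Binary.Lex.Strict using (Lex-≤; ≤-dec)
open import Function.Base using (_∘_)
open import Function.Definitions using (Injective)
open import Level using (0ℓ)
open import Relation.Binary.PropositionalEquality using (_≡_; refl)
open import Relation.Nullary.Decidable using (Dec; map′; ¬?; _×-dec_; _⊎-dec_; _→-dec_)
open import Relation.Unary using (Pred; Decidable; _∪_; _∩_; _∉_)
import Relation.Unary as U

Word : ℕ → ℕ → Set
Word k n = Vec (Fin k) n

-- The t-th length-n window of the cyclic sequence s; positions are 0-based
-- and taken modulo L, so windows may wrap around (also more than once).
window : ∀ {A : Set} {L} → Vec A L → (n : ℕ) → Fin L → Vec A n
window {L = suc L} s n t = tabulate λ j → lookup s ((toℕ t + toℕ j) mod suc L)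

module _ {k n : ℕ} where

  -- All strings compared here have the same length, so the proper-prefix
  -- case of the lexicographic order never arises.
  _≤ₗ_ : Word k n → Word k n → Set
  _≤ₗ_ = Lex-≤ _≡_ Fin._<_

  -- [ α ]: the rotation of α = a₀⋯aₙ₋₁ by i is aᵢ⋯aₙ₋₁a₀⋯aᵢ₋₁, that is,
  -- the i-th length-n window of α read cyclically.
  Rotations : Word k n → Pred (Word k n) 0ℓ
  Rotations α β = ∃ λ (i : Fin n) → β ≡ window α n i

  IsSmallest : Pred (Word k n) 0ℓ → Pred (Word k n) 0ℓ
  IsSmallest P α = P α × (∀ β → P β → α ≤ₗ β)

  Necklace : Pred (Word k n) 0ℓ
  Necklace α = IsSmallest (Rotations α) α

  Bracelet : Pred (Word k n) 0ℓ
  Bracelet α = IsSmallest (Rotations α ∪ Rotations (reverse α)) α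

  Symmetric : Pred (Word k n) 0ℓ
  Symmetric α = Necklace α × reverse α U.∈ Rotations α

  Asymmetric : Pred (Word k n) 0ℓ
  Asymmetric α = Necklace α × reverse α ∉ Rotations α

𝐀 : ∀ k n → Pred (Word k n) 0ℓ
𝐀 k n = Bracelet ∩ Asymmetric

𝐒 : ∀ k n → Pred (Word k n) 0ℓ
𝐒 k n β = ∃ λ α → α U.∈ 𝐀 k n × β U.∈ Rotations α

-- 𝐒 k n is decidable, so its cardinality can be obtained by filtering the
-- duplicate-free list of all k ^ n strings.

words : ∀ k n → List (Word k n)
words k zero    = [] ∷ []
words k (suc n) = cartesianProductWith _∷_ (allFin k) (words k n)

∈-words : ∀ {k n} (α : Word k n) → α ∈ words k n
∈-words []      = here refl
∈-words (a ∷ α) = ∈-cartesianProductWith⁺ _∷_ (∈-allFin a) (∈-words α)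

words-unique : ∀ k n → Unique (words k n)
words-unique k zero    = All.[] AllPairs.∷ AllPairs.[]
words-unique k (suc n) =
  cartesianProductWith⁺ _∷_ Vec.∷-injective (allFin⁺ k) (words-unique k n)

module _ {k n : ℕ} where

  ∀word? : {P : Pred (Word k n) 0ℓ} → Decidable P → Dec (∀ α → P α)
  ∀word? P? = map′ (λ ps α → All.lookup ps (∈-words α)) (λ p → All.universal p _)
                   (All.all? P? (words k n))

  ∃word? : {P : Pred (Word k n) 0ℓ} → Decidable P → Dec (∃ P)
  ∃word? P? = map′ (λ p → let α , _ , pα = find p in α , pα) (λ (α , pα) → lose (∈-words α) pα)
                   (any? P? (words k n))

  rotations? : (α : Word k n) → Decidable (Rotations α)
  rotations? α β = Fin.any? λ i → Vec.≡-dec Fin._≟_ β (window α n i)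

  isSmallest? : {P : Pred (Word k n) 0ℓ} → Decidable P → Decidable (IsSmallest P)
  isSmallest? P? α =
    P? α ×-dec ∀word? λ β → P? β →-dec ≤-dec Fin._≟_ Fin._<?_ α β

  𝐀? : Decidable (𝐀 k n)
  𝐀? α =
    isSmallest? (λ β → rotations? α β ⊎-dec rotations? (reverse α) β) α
    ×-dec (isSmallest? (rotations? α) α ×-dec ¬? (rotations? α (reverse α)))

  𝐒? : Decidable (𝐒 k n)
  𝐒? β = ∃word? λ α → 𝐀? α ×-dec rotations? α β

∣𝐒∣ : ℕ → ℕ → ℕ
∣𝐒∣ k n = length (filter 𝐒? (words k n))

-- The windows of s are exactly the elements of P, each occurring once.
UniversalCycle : ∀ {k n L} → Pred (Word k n) 0ℓ → Vec (Fin k) L → Set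
UniversalCycle {n = n} P s =
  (∀ t → window s n t U.∈ P) ×
  (∀ β → β U.∈ P → ∃! _≡_ λ t → window s n t ≡ β)

-- Injectivity of the family w₁,…,w_L,w₁ᴿ,…,w_Lᴿ, indexed by Fin L ⊎ Fin L.
Orientable : ∀ {k L} → ℕ → Vec (Fin k) L → Set
Orientable {L = L} n s =
  Injective {A = Fin L ⊎ Fin L} _≡_ _≡_ [ window s n , reverse ∘ window s n ]′

{-# OPTIONS --safe #-}

-- Call a string oriented if it precedes every rotation of its reversal. Oriented strings lie
-- in 𝐒, and the asymmetric bracelets are oriented. The set 𝐒 is closed under rotation; two
-- closed walks in the de Bruijn graph that contain x ∷ α and y ∷ α can be spliced, so it suffices
-- to connect every oriented string to 0 ⋯ 0 1 m, with m the largest letter, by changing one letter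
-- at a time through oriented strings.
--
-- Raising the last letter to m, raising a zero before it to 1 and lowering the first nonzero
-- letter to 1 all preserve orientation and give 0ʲ 1 0ᵉ y w m with y ≠ 0. Replacing the first 1
-- by 0 is then allowed if y < m, and also if y = m and w starts with 0ʲ; if y = m and w does not
-- start with 0ʲ, then y may be lowered to 1 beforehand. After lowering y to 1, the initial run of
-- zeros is strictly longer than all others, and this alone makes 0ⁱ 1 v m oriented. So the letters
-- of v can be changed to 1 one by one, and the ones of 0ⁱ 1 ⋯ 1 m can be changed to 0 from the left.
--
-- Orientability holds because reversal maps 𝐒 into its complement.

module Submission where

open import Defs
open import Data.Empty using (⊥-elim)
open import Data.Fin.Base using (Fin; fromℕ; toℕ; inject₁)
import Data.Fin.Base as Fin
import Data.Fin.Properties as Fin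
open import Data.Fin.Relation.Unary.Top using (view; ‵fromℕ; ‵inject₁)
open import Data.List.Base as List using (List; []; _∷_; _++_; [_]; length; replicate; applyUpTo; filter; initLast; _∷ʳ′_)
open import Data.List.Membership.Propositional using (_∈_)
import Data.List.Membership.Propositional.Properties as ∈
import Data.List.Properties as List
open import Data.List.Relation.Binary.Permutation.Propositional using (_↭_; ↭-refl; ↭-sym; ↭-trans; prep; swap; ↭⇒↭ₛ)
import Data.List.Relation.Binary.Permutation.Propositional.Properties as ↭
import Data.List.Relation.Binary.Permutation.Setoid.Properties as ↭ₛ
open import Data.List.Relation.Binary.Subset.Propositional using (_⊆_)
import Data.List.Relation.Unary.All as All
open import Data.List.Relation.Unary.AllPairs using (_∷_)
open import Data.List.Relation.Unary.Any as Any using (here; there)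
import Data.List.Relation.Unary.Any.Properties as Any
open import Data.List.Relation.Unary.Unique.Propositional using (Unique)
import Data.List.Relation.Unary.Unique.Propositional.Properties as Unique
open import Data.Nat.Base using (ℕ; zero; suc; _+_; _*_; _∸_; _≤_; _<_; z≤n; s≤s)
import Data.Nat.Base as ℕ
open import Data.Nat.DivMod using (_%_; _mod_; m%n<n; m<n⇒m%n≡m; m%n%n≡m%n; n%n≡0; [m+n]%n≡m%n; %-distribˡ-+)
import Data.Nat.Properties as ℕ
open import Data.Product using (Σ; ∃; ∃₂; _×_; _,_; proj₁; proj₂)
open import Data.Sum.Base using (_⊎_; inj₁; inj₂; [_,_]′)
open import Data.Vec.Base as Vec using (Vec; []; _∷_; lookup; tabulate; toList; head)
import Data.Vec.Properties as Vec
open import Data.Vec.Relation.Binary.Lex.Core using (base; this; next)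
import Data.Vec.Relation.Binary.Lex.Strict as Lex
import Data.Vec.Relation.Binary.Pointwise.Inductive as Pointwise
open import Function.Base using (_∘_)
open import Level using (0ℓ)
open import Relation.Binary.Construct.Closure.ReflexiveTransitive as Star using (Star; ε; _◅_; _◅◅_)
open import Relation.Binary.PropositionalEquality using (_≡_; _≢_; refl; sym; trans; cong; cong₂; subst; subst₂; resp₂; setoid; isEquivalence; module ≡-Reasoning)
open import Relation.Binary.Structures using (IsEquivalence)
open import Relation.Nullary using (¬_; contradiction; yes; no; Dec)
open import Relation.Unary using (Pred; Decidable)

-- Splitting, reversing and repeating in lists.

module _ {A : Set} where
  open import Data.List.Base using (reverse; _∷ʳ_)

  ++-∷-split : ∀ (p : List A) {q} b {x c} → p ++ q ≡ b ++ x ∷ c →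
    (∃₂ λ c₁ c₂ → c ≡ c₁ ++ c₂ × p ≡ b ++ x ∷ c₁ × q ≡ c₂) ⊎
    (∃₂ λ b₁ b₂ → b ≡ b₁ ++ b₂ × p ≡ b₁ × q ≡ b₂ ++ x ∷ c)
  ++-∷-split []      b       eq   = inj₂ ([] , b , refl , refl , eq)
  ++-∷-split (_ ∷ p) []      refl = inj₁ (p , _ , refl , refl , refl)
  ++-∷-split (_ ∷ p) (y ∷ b) eq with List.∷-injective eq
  ... | refl , eq′ with ++-∷-split p b eq′
  ...   | inj₁ (c₁ , c₂ , eq₁ , eq₂ , eq₃) = inj₁ (c₁ , c₂ , eq₁ , cong (y ∷_) eq₂ , eq₃)
  ...   | inj₂ (b₁ , b₂ , eq₁ , eq₂ , eq₃) = inj₂ (y ∷ b₁ , b₂ , cong (y ∷_) eq₁ , cong (y ∷_) eq₂ , eq₃)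

  ++-∷ʳ-split : ∀ (p : List A) {q} b {x} → p ++ q ≡ b ∷ʳ x →
    (p ≡ b ∷ʳ x × q ≡ []) ⊎ (∃ λ q′ → q ≡ q′ ∷ʳ x × p ++ q′ ≡ b)
  ++-∷ʳ-split p {q} b eq with initLast q
  ... | []        = inj₁ (trans (sym (List.++-identityʳ p)) eq , refl)
  ... | q′ ∷ʳ′ z with List.∷ʳ-injective (p ++ q′) b (trans (List.++-assoc p q′ [ z ]) eq)
  ...   | eq′ , refl = inj₂ (q′ , refl , eq′)

  reverse-∷ʳ : ∀ (xs : List A) x → reverse (xs ∷ʳ x) ≡ x ∷ reverse xs
  reverse-∷ʳ xs x = List.reverse-++ xs [ x ]

  reverse-++-∷ : ∀ (xs : List A) x ys →
    reverse (xs ++ x ∷ ys) ≡ reverse ys ++ x ∷ reverse xs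
  reverse-++-∷ xs x ys = begin
    reverse (xs ++ x ∷ ys)          ≡⟨ List.reverse-++ xs (x ∷ ys) ⟩
    reverse (x ∷ ys) ++ reverse xs  ≡⟨ cong (_++ reverse xs) (List.unfold-reverse x ys) ⟩
    (reverse ys ∷ʳ x) ++ reverse xs ≡⟨ List.∷ʳ-++ (reverse ys) x (reverse xs) ⟩
    reverse ys ++ x ∷ reverse xs    ∎
    where open ≡-Reasoning

  replicate-∷ʳ : ∀ n (x : A) → replicate n x ∷ʳ x ≡ x ∷ replicate n x
  replicate-∷ʳ zero    x = refl
  replicate-∷ʳ (suc n) x = cong (x ∷_) (replicate-∷ʳ n x)

  reverse-replicate : ∀ n (x : A) → reverse (replicate n x) ≡ replicate n x
  reverse-replicate zero    x = refl
  reverse-replicate (suc n) x = begin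
    reverse (x ∷ replicate n x)  ≡⟨ List.unfold-reverse x (replicate n x) ⟩
    reverse (replicate n x) ∷ʳ x ≡⟨ cong (_∷ʳ x) (reverse-replicate n x) ⟩
    replicate n x ∷ʳ x           ≡⟨ replicate-∷ʳ n x ⟩
    x ∷ replicate n x            ∎
    where open ≡-Reasoning

  replicate-++ : ∀ m n {x : A} {ys} →
    replicate m x ++ replicate n x ++ ys ≡ replicate (m + n) x ++ ys
  replicate-++ zero    n = refl
  replicate-++ (suc m) n = cong (_ ∷_) (replicate-++ m n)

  ∈-replicate⇒≡ : ∀ n {x y : A} b {c} → b ++ y ∷ c ≡ replicate n x → y ≡ x
  ∈-replicate⇒≡ (suc n) []      eq = List.∷-injectiveˡ eq
  ∈-replicate⇒≡ (suc n) (_ ∷ b) eq = ∈-replicate⇒≡ n b (List.∷-injectiveʳ eq)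

  prefix-replicate : ∀ n {x : A} b {c} → b ++ c ≡ replicate n x →
    ∃ λ i → i ≤ n × b ≡ replicate i x
  prefix-replicate n       []      eq = 0 , z≤n , refl
  prefix-replicate (suc n) (_ ∷ b) eq with List.∷-injective eq
  ... | refl , eq′ with prefix-replicate n b eq′
  ...   | i , i≤n , refl = suc i , s≤s i≤n , refl

prefix? : ∀ {k} (p l : List (Fin k)) → Dec (∃ λ t → l ≡ p ++ t)
prefix? []      l       = yes (l , refl)
prefix? (x ∷ p) []      = no λ ()
prefix? (x ∷ p) (y ∷ l) with y Fin.≟ x | prefix? p l
... | yes refl | yes (t , refl) = yes (t , refl)
... | no y≢x   | _     = no λ (t , eq) → y≢x (List.∷-injectiveˡ eq)
... | _        | no ¬p = no λ (t , eq) → ¬p (t , List.∷-injectiveʳ eq)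

-- Strings that precede all rotations of their reversals

module Oriented {k : ℕ} where
  open import Data.List.Base using (reverse; _∷ʳ_)

  Letter : Set
  Letter = Fin (3 + k)

  Str : Set
  Str = List Letter

  pattern 𝟎 = Fin.zero
  pattern 𝟏 = Fin.suc Fin.zero

  top : Letter
  top = fromℕ (2 + k)

  0^_ : ℕ → Str
  0^ j = replicate j 𝟎

  infix 4 _<ᶠ_ _≺_
  infix 9 0^_

  _<ᶠ_ : Letter → Letter → Set
  _<ᶠ_ = Fin._<_

  0<letter : ∀ {x : Letter} → x ≢ 𝟎 → 𝟎 <ᶠ x
  0<letter {𝟎}         x≢0 = contradiction refl x≢0
  0<letter {Fin.suc _} _   = s≤s z≤n

  1<letter : ∀ {x : Letter} → x ≢ 𝟎 → x ≢ 𝟏 → 𝟏 <ᶠ x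
  1<letter {𝟎}                   x≢0 _   = contradiction refl x≢0
  1<letter {𝟏}                   _   x≢1 = contradiction refl x≢1
  1<letter {Fin.suc (Fin.suc _)} _   _   = s≤s (s≤s z≤n)

  ≢top⇒<top : ∀ {x : Letter} → x ≢ top → x <ᶠ top
  ≢top⇒<top {x} x≢top = Fin.≤∧≢⇒< (Fin.≤fromℕ x) x≢top

  ≯top : ∀ {x : Letter} → ¬ (top <ᶠ x)
  ≯top {x} top<x = ℕ.<⇒≱ top<x (Fin.≤fromℕ x)

  ≮0 : ∀ {x} → ¬ (x <ᶠ 𝟎)
  ≮0 ()

  data _≺_ : Str → Str → Set where
    here : ∀ {x y xs ys} → x <ᶠ y → x ∷ xs ≺ y ∷ ys
    next : ∀ {x xs ys} → xs ≺ ys → x ∷ xs ≺ x ∷ ys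

  ≺-respʳ : ∀ {a b c} → b ≡ c → a ≺ b → a ≺ c
  ≺-respʳ refl a≺b = a≺b

  ≺-irrefl : ∀ {a} → ¬ (a ≺ a)
  ≺-irrefl (here x<x) = Fin.<-irrefl refl x<x
  ≺-irrefl (next p)   = ≺-irrefl p

  ≺-trans : ∀ {a b c} → a ≺ b → b ≺ c → a ≺ c
  ≺-trans (here p) (here q) = here (Fin.<-trans p q)
  ≺-trans (here p) (next q) = here p
  ≺-trans (next p) (here q) = here q
  ≺-trans (next p) (next q) = next (≺-trans p q)

  ++-≺ : ∀ p {a b} → a ≺ b → p ++ a ≺ p ++ b
  ++-≺ []      a≺b = a≺b
  ++-≺ (x ∷ p) a≺b = next (++-≺ p a≺b)

  ++-≺⁻ : ∀ p {a b} → p ++ a ≺ p ++ b → a ≺ b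
  ++-≺⁻ []      a≺b        = a≺b
  ++-≺⁻ (x ∷ p) (here x<x) = ⊥-elim (Fin.<-irrefl refl x<x)
  ++-≺⁻ (x ∷ p) (next a≺b) = ++-≺⁻ p a≺b

  -- The rotations of the reversal of u ++ v are the strings
  -- reverse u ++ reverse v.
  Oriented : Str → Set
  Oriented a = ∀ u v → u ++ v ≡ a → a ≺ reverse u ++ reverse v

  -- The ways r ++ x ∷ s of reading b ++ x ∷ c backwards and cyclically, for any x.
  data Backwards (b c : Str) : Str → Str → Set where
    wrapped : ∀ c₁ c₂ → c ≡ c₁ ++ c₂ → Backwards b c (reverse c₁) (reverse b ++ reverse c₂)
    direct  : ∀ b₁ b₂ → b ≡ b₁ ++ b₂ → Backwards b c (reverse b₁ ++ reverse c) (reverse b₂)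

  private
    wrapped-≡ : ∀ b (x : Letter) c₁ c₂ → reverse (b ++ x ∷ c₁) ++ reverse c₂
                ≡ reverse c₁ ++ x ∷ reverse b ++ reverse c₂
    wrapped-≡ b x c₁ c₂ = begin
      reverse (b ++ x ∷ c₁) ++ reverse c₂         ≡⟨ cong (_++ reverse c₂) (reverse-++-∷ b x c₁) ⟩
      (reverse c₁ ++ x ∷ reverse b) ++ reverse c₂ ≡⟨ List.++-assoc (reverse c₁) _ _ ⟩
      reverse c₁ ++ x ∷ reverse b ++ reverse c₂   ∎
      where open ≡-Reasoning

    direct-≡ : ∀ b₁ b₂ (x : Letter) c → reverse b₁ ++ reverse (b₂ ++ x ∷ c)
                ≡ (reverse b₁ ++ reverse c) ++ x ∷ reverse b₂
    direct-≡ b₁ b₂ x c = begin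
      reverse b₁ ++ reverse (b₂ ++ x ∷ c)         ≡⟨ cong (reverse b₁ ++_) (reverse-++-∷ b₂ x c) ⟩
      reverse b₁ ++ reverse c ++ x ∷ reverse b₂   ≡⟨ List.++-assoc (reverse b₁) _ _ ⟨
      (reverse b₁ ++ reverse c) ++ x ∷ reverse b₂ ∎
      where open ≡-Reasoning

  ≺-backwards : ∀ b {x c r s} → Oriented (b ++ x ∷ c) → Backwards b c r s → b ++ x ∷ c ≺ r ++ x ∷ s
  ≺-backwards b {x} o (wrapped c₁ c₂ refl) =
    ≺-respʳ (wrapped-≡ b x c₁ c₂) (o (b ++ x ∷ c₁) c₂ (List.++-assoc b _ _))
  ≺-backwards _ {x} {c} o (direct b₁ b₂ refl) =
    ≺-respʳ (direct-≡ b₁ b₂ x c) (o b₁ (b₂ ++ x ∷ c) (sym (List.++-assoc b₁ _ _)))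

  -- A cut of `b ++ x ∷ c` falls either behind `x`, which gives `wrapped`, or in front of it, which
  -- gives `direct`. So the two constructors exhaust the rotations of the reversal.
  ≺-backwards⁻ : ∀ b {x c} → (∀ {r s} → Backwards b c r s → b ++ x ∷ c ≺ r ++ x ∷ s) → Oriented (b ++ x ∷ c)
  ≺-backwards⁻ b {x} {c} h u v eq with ++-∷-split u b eq
  ... | inj₁ (c₁ , c₂ , eq₁ , refl , refl) =
    ≺-respʳ (sym (wrapped-≡ b x c₁ c₂)) (h (wrapped c₁ c₂ eq₁))
  ... | inj₂ (b₁ , b₂ , eq₁ , refl , refl) =
    ≺-respʳ (sym (direct-≡ b₁ b₂ x c)) (h (direct b₁ b₂ eq₁))

  -- Neither `r` nor `s` involves the distinguished letter, so the change affects each rotation of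
  -- the reversal only in the place behind `r`. Preserving orientation thus becomes one implication
  -- between comparisons for each `r` and `s`.
  change : ∀ b {x y c} → (∀ {r s} → Backwards b c r s → b ++ x ∷ c ≺ r ++ x ∷ s → b ++ y ∷ c ≺ r ++ y ∷ s) →
           Oriented (b ++ x ∷ c) → Oriented (b ++ y ∷ c)
  change b h o = ≺-backwards⁻ b λ bw → h bw (≺-backwards b o bw)

  -- Raising the last two letters and lowering nonzero ones.

  backwards-length : ∀ {b c r s} → Backwards b c r s → length r + length s ≡ length b + length c
  backwards-length {b} (wrapped c₁ c₂ refl)
    rewrite List.length-++ (reverse b) {reverse c₂} | List.length-reverse b
          | List.length-reverse c₁ | List.length-reverse c₂ | List.length-++ c₁ {c₂} =
    trans (sym (ℕ.+-assoc (length c₁) _ _))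
      (trans (cong (_+ length c₂) (ℕ.+-comm (length c₁) (length b))) (ℕ.+-assoc (length b) _ _))
  backwards-length {c = c} (direct b₁ b₂ refl)
    rewrite List.length-++ (reverse b₁) {reverse c} | List.length-reverse c
          | List.length-reverse b₁ | List.length-reverse b₂ | List.length-++ b₁ {b₂} =
    trans (ℕ.+-assoc (length b₁) _ _)
      (trans (cong (length b₁ +_) (ℕ.+-comm (length c) _)) (sym (ℕ.+-assoc (length b₁) _ _)))

  -- A comparison decided within the first `length r` letters is untouched. Otherwise `r` is shorter
  -- than `b`, and the letter of `b` that meets `x` is at most `x`, hence below `y`.
  raise-last : ∀ b {x y} → x <ᶠ y → Oriented (b ∷ʳ x) → Oriented (b ∷ʳ y)
  raise-last b {x} {y} x<y =
    change b λ {r} bw → go b r (trans (backwards-length bw) (ℕ.+-identityʳ (length b)))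
    where
    go : ∀ b r {s} → length r + length s ≡ length b → b ∷ʳ x ≺ r ++ x ∷ s → b ∷ʳ y ≺ r ++ y ∷ s
    go []      []            _  (here x<x) = ⊥-elim (Fin.<-irrefl refl x<x)
    go []      []      {[]}  _  (next ())
    go []      []      {_ ∷ _} () (next _)
    go []      (_ ∷ _)       () _
    go (_ ∷ b) []            _  (here z<x) = here (Fin.<-trans z<x x<y)
    go (_ ∷ b) []            _  (next _)   = here x<y
    go (_ ∷ b) (_ ∷ r)       eq (here z<z′) = here z<z′
    go (_ ∷ b) (_ ∷ r)       eq (next p)   = next (go b r (ℕ.suc-injective eq) p)

  -- If a letter of `z ∷ b` meets the changed one undecided, it is `𝟎` and becomes the smaller. The
  -- raised letter on the left can meet a letter of `r` only if `s` is empty, and that letter is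
  -- then `top`; `Ends` carries this fact through the recursion.
  raise-second-last : ∀ z b → Oriented ((z ∷ b) ++ 𝟎 ∷ [ top ]) → Oriented ((z ∷ b) ++ 𝟏 ∷ [ top ])
  raise-second-last z b =
    change (z ∷ b) λ {r} bw → go (z ∷ b) r (trans (backwards-length bw) (ℕ.+-comm (length (z ∷ b)) 1)) (ends bw)
    where
    Ends : Str → Str → Set
    Ends r s = s ≢ [] ⊎ ∃ λ r′ → r ≡ r′ ∷ʳ top

    ends : ∀ {r s} → Backwards (z ∷ b) [ top ] r s → Ends r s
    -- Here `s` contains the reversal of `z ∷ b`; this is what the nonempty front is for.
    ends (wrapped c₁ c₂ _) = inj₁ λ eq → reverse≢[] (List.++-conicalˡ _ _ eq)
      where
      reverse≢[] : reverse (z ∷ b) ≢ []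
      reverse≢[] eq with () ← trans (sym (List.length-reverse (z ∷ b))) (cong length eq)
    ends (direct b₁ b₂ _)  = inj₂ (reverse b₁ , refl)

    shift : ∀ {z r s n} → length r + length s ≡ suc n → Ends (z ∷ r) s → Ends r s
    shift eq (inj₁ s≢[])             = inj₁ s≢[]
    shift eq (inj₂ ([] , refl))      = inj₁ λ { refl → ℕ.0≢1+n eq }
    shift eq (inj₂ (_ ∷ r′ , refl))  = inj₂ (r′ , refl)

    go : ∀ b r {s} → length r + length s ≡ suc (length b) → Ends r s →
         b ++ 𝟎 ∷ [ top ] ≺ r ++ 𝟎 ∷ s → b ++ 𝟏 ∷ [ top ] ≺ r ++ 𝟏 ∷ s
    go []      []                  _  _ (next (here top<x)) = ⊥-elim (≯top top<x)
    go []      []      {_ ∷ []}    _  _ (next (next ()))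
    go []      (x ∷ [])     {[]}    _  (inj₁ s≢[]) _ = contradiction refl s≢[]
    go []      (x ∷ [])     {[]}    _  (inj₂ (r′ , eq)) _ with List.∷ʳ-injectiveʳ [] r′ eq
    ... | refl = here (s≤s (s≤s z≤n))
    go (_ ∷ b) []                  _  _ (here ())
    go (_ ∷ b) []                  _  _ (next _)      = here (s≤s z≤n)
    go (_ ∷ b) (_ ∷ r)             eq e (here z<z′) = here z<z′
    go (_ ∷ b) (_ ∷ r)             eq e (next p) =
      next (go b r (ℕ.suc-injective eq) (shift (ℕ.suc-injective eq) e) p)

  -- Suppose the comparison reaches the change. If `r` is shorter than `0^ j`, a leading `𝟎` meets
  -- `y`, which is still larger; if it is longer, the left side drops strictly; if the lengths
  -- agree, both sides receive `y` in the same place.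
  lower-≺ : ∀ j {x y c} r {s} → y ≢ 𝟎 → y <ᶠ x →
            0^ j ++ x ∷ c ≺ r ++ x ∷ s → 0^ j ++ y ∷ c ≺ r ++ y ∷ s
  lower-≺ zero    []      y≢0 y<x (here x<x)  = ⊥-elim (Fin.<-irrefl refl x<x)
  lower-≺ zero    []      y≢0 y<x (next p)    = next p
  lower-≺ zero    (_ ∷ r) y≢0 y<x (here x<z)  = here (Fin.<-trans y<x x<z)
  lower-≺ zero    (_ ∷ r) y≢0 y<x (next p)    = here y<x
  lower-≺ (suc j) []      y≢0 y<x _           = here (0<letter y≢0)
  lower-≺ (suc j) (_ ∷ r) y≢0 y<x (here z<z′) = here z<z′
  lower-≺ (suc j) (_ ∷ r) y≢0 y<x (next p)    = next (lower-≺ j r y≢0 y<x p)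

  lower : ∀ j {x y c} → y ≢ 𝟎 → y <ᶠ x → Oriented (0^ j ++ x ∷ c) → Oriented (0^ j ++ y ∷ c)
  lower j y≢0 y<x = change (0^ j) λ {r} _ → lower-≺ j r y≢0 y<x

  top∉0^ : ∀ b₁ c {i} → reverse b₁ ++ reverse (c ∷ʳ top) ≢ 0^ i
  top∉0^ b₁ c {i} eq with () ← ∈-replicate⇒≡ i (reverse b₁) (trans (cong (reverse b₁ ++_) (sym (reverse-∷ʳ c top))) eq)

  reverse-≡-0^ : ∀ c {i} → reverse c ≡ 0^ i → c ≡ 0^ i
  reverse-≡-0^ c {i} eq = List.reverse-injective (trans eq (sym (reverse-replicate i 𝟎)))

  -- Lowering y can only fail when y gets compared with the leading 𝟏, that is, for r ≡ 0^ j.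
  lower-second : ∀ j e {y w} → 𝟏 <ᶠ y → ¬ (∃ λ t → w ≡ 0^ j ++ t) →
    Oriented ((0^ j ++ 𝟏 ∷ 0^ e) ++ y ∷ w ∷ʳ top) → Oriented ((0^ j ++ 𝟏 ∷ 0^ e) ++ 𝟏 ∷ w ∷ʳ top)
  lower-second j e {y} {w} 1<y ¬prefix = change (0^ j ++ 𝟏 ∷ 0^ e) λ {r} bw → go j r (r≢ bw)
    where
    r≢ : ∀ {r s} → Backwards (0^ j ++ 𝟏 ∷ 0^ e) (w ∷ʳ top) r s → r ≢ 0^ j
    r≢ (wrapped c₁ c₂ eq) r≡ with ++-∷ʳ-split c₁ w (sym eq)
    ... | inj₁ (refl , _)       = top∉0^ [] w r≡
    -- If `reverse c₁` were `0^ j`, then `w` would start with `0^ j`.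
    ... | inj₂ (c₂′ , _ , eq′)  = ¬prefix (c₂′ , trans (sym eq′) (cong (_++ c₂′) (reverse-≡-0^ c₁ r≡)))
    r≢ (direct b₁ b₂ _) = top∉0^ b₁ w

    go : ∀ j r {c s} → r ≢ 0^ j → (0^ j ++ 𝟏 ∷ 0^ e) ++ y ∷ c ≺ r ++ y ∷ s →
         (0^ j ++ 𝟏 ∷ 0^ e) ++ 𝟏 ∷ c ≺ r ++ 𝟏 ∷ s
    go zero    []      r≢ _          = contradiction refl r≢
    go zero    (_ ∷ r) r≢ (here 1<z) = here 1<z
    -- Behind the common `𝟏`, `y` is the first nonzero letter after `e` zeros.
    go zero    (_ ∷ r) r≢ (next p)   = next (lower-≺ e r (λ ()) 1<y p)
    go (suc j) []      r≢ _          = here (s≤s z≤n)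
    go (suc j) (_ ∷ r) r≢ (here 0<z) = here 0<z
    go (suc j) (_ ∷ r) r≢ (next p)   = next (go j r (r≢ ∘ cong (𝟎 ∷_)) p)

  -- Lengthening the initial run of zeros.

  data NonzeroWithin : ℕ → Str → Set where
    here : ∀ {j x l} → x ≢ 𝟎 → NonzeroWithin (suc j) (x ∷ l)
    next : ∀ {j l} → NonzeroWithin j l → NonzeroWithin (suc j) (𝟎 ∷ l)

  nonzeroWithin-≺ : ∀ {j l c} → NonzeroWithin j l → 0^ j ++ c ≺ l
  nonzeroWithin-≺ (here x≢0) = here (0<letter x≢0)
  nonzeroWithin-≺ (next p)   = next (nonzeroWithin-≺ p)

  ≺-nonzeroWithin : ∀ j {x c l} → x ≢ 𝟎 → 0^ j ++ x ∷ c ≺ l → NonzeroWithin (suc j) l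
  ≺-nonzeroWithin zero    x≢0 (here x<y) = here λ { refl → ≮0 x<y }
  ≺-nonzeroWithin zero    x≢0 (next _)   = here x≢0
  ≺-nonzeroWithin (suc j) x≢0 (here 0<y) = here λ { refl → ≮0 {𝟎} 0<y }
  ≺-nonzeroWithin (suc j) x≢0 (next p)   = next (≺-nonzeroWithin j x≢0 p)

  nonzeroWithin-+ : ∀ {j l} e → NonzeroWithin j l → NonzeroWithin (j + e) l
  nonzeroWithin-+ e (here x≢0) = here x≢0
  nonzeroWithin-+ e (next p)   = next (nonzeroWithin-+ e p)

  nonzeroWithin-set : ∀ {j} r {x y s s′} → y ≢ 𝟎 → NonzeroWithin j (r ++ x ∷ s) → NonzeroWithin j (r ++ y ∷ s′)
  nonzeroWithin-set []      y≢0 (here _)   = here y≢0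
  nonzeroWithin-set []      y≢0 (next _)   = here y≢0
  nonzeroWithin-set (_ ∷ r) y≢0 (here z≢0) = here z≢0
  nonzeroWithin-set (_ ∷ r) y≢0 (next p)   = next (nonzeroWithin-set r y≢0 p)

  nonzeroWithin-prefix : ∀ {j} r {s} → NonzeroWithin j (r ++ s) → (∃ λ i → r ≡ 0^ i) ⊎ (∀ s′ → NonzeroWithin j (r ++ s′))
  nonzeroWithin-prefix []      _          = inj₁ (0 , refl)
  nonzeroWithin-prefix (_ ∷ r) (here z≢0) = inj₂ λ _ → here z≢0
  nonzeroWithin-prefix (_ ∷ r) (next p) with nonzeroWithin-prefix r p
  ... | inj₁ (i , refl) = inj₁ (suc i , refl)
  ... | inj₂ h          = inj₂ λ s′ → next (h s′)

  0^-∷ : ∀ j {c} → 0^ j ++ 𝟎 ∷ c ≡ 0^ (suc j) ++ c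
  0^-∷ zero    = refl
  0^-∷ (suc j) = cong (𝟎 ∷_) (0^-∷ j)

  -- The hypothesis compares `y ∷ w ∷ʳ top` with its own reversal. Any longer suffix `u` starts with
  -- `𝟎`, which is below `top`.
  suffix-≺ : ∀ e i {y w u} → y ≢ 𝟎 → y ∷ w ∷ʳ top ≺ top ∷ reverse (y ∷ w) →
             0^ e ++ y ∷ w ≡ 0^ i ++ u → u ∷ʳ top ≺ top ∷ reverse u
  suffix-≺ zero    zero    y≢0 h refl = h
  suffix-≺ zero    (suc i) y≢0 h eq   = contradiction (List.∷-injectiveˡ eq) y≢0
  suffix-≺ (suc e) zero    y≢0 h refl = here (s≤s z≤n)
  suffix-≺ (suc e) (suc i) y≢0 h eq   = suffix-≺ e i y≢0 h (List.∷-injectiveʳ eq)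

  -- Orientation puts a nonzero letter among the first `suc j` letters of `r ++ x ∷ s`. If it lies
  -- in `r`, it survives and beats `0^ (suc j)`. Otherwise `r` consists of zeros; as it avoids
  -- `top`, it reverses a prefix `0^ i` of the part behind `x`. Both sides then start with
  -- `j + suc i` zeros, and `suffix-≺` compares what remains.
  lengthen : ∀ j e {x y w} → x ≢ 𝟎 → y ≢ 𝟎 → y ∷ w ∷ʳ top ≺ top ∷ reverse (y ∷ w) →
    Oriented (0^ j ++ x ∷ (0^ e ++ y ∷ w) ∷ʳ top) → Oriented (0^ j ++ 𝟎 ∷ (0^ e ++ y ∷ w) ∷ʳ top)
  lengthen j e {x} {y} {w} x≢0 y≢0 h = change (0^ j) go
    where
    go : ∀ {r s} → Backwards (0^ j) ((0^ e ++ y ∷ w) ∷ʳ top) r s →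
         0^ j ++ x ∷ (0^ e ++ y ∷ w) ∷ʳ top ≺ r ++ x ∷ s →
         0^ j ++ 𝟎 ∷ (0^ e ++ y ∷ w) ∷ʳ top ≺ r ++ 𝟎 ∷ s
    go {r} bw p with nonzeroWithin-prefix r (≺-nonzeroWithin j x≢0 p)
    ... | inj₂ low = subst (_≺ _) (sym (0^-∷ j)) (nonzeroWithin-≺ (low _))
    go (direct b₁ b₂ _) p | inj₁ (i , r≡) = ⊥-elim (top∉0^ b₁ (0^ e ++ y ∷ w) r≡)
    go (wrapped c₁ c₂ eq) p | inj₁ (i , r≡) with ++-∷ʳ-split c₁ (0^ e ++ y ∷ w) (sym eq)
    ... | inj₁ (refl , _)        = ⊥-elim (top∉0^ [] (0^ e ++ y ∷ w) r≡)
    ... | inj₂ (u , refl , eq′) with reverse-≡-0^ c₁ r≡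
    ...   | refl = subst₂ _≺_ left right (++-≺ (0^ (j + suc i)) (suffix-≺ e i y≢0 h (sym eq′)))
      where
      open ≡-Reasoning
      left : 0^ (j + suc i) ++ u ∷ʳ top ≡ 0^ j ++ 𝟎 ∷ (0^ e ++ y ∷ w) ∷ʳ top
      left = begin
        0^ (j + suc i) ++ u ∷ʳ top         ≡⟨ replicate-++ j (suc i) ⟨
        0^ j ++ 𝟎 ∷ 0^ i ++ u ∷ʳ top       ≡⟨ cong (λ l → 0^ j ++ 𝟎 ∷ l) eq ⟨
        0^ j ++ 𝟎 ∷ (0^ e ++ y ∷ w) ∷ʳ top ∎
      right : 0^ (j + suc i) ++ top ∷ reverse u
              ≡ reverse (0^ i) ++ 𝟎 ∷ reverse (0^ j) ++ reverse (u ∷ʳ top)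
      right = begin
        0^ (j + suc i) ++ top ∷ reverse u
          ≡⟨ cong (λ n → 0^ n ++ top ∷ reverse u)
               (trans (ℕ.+-suc j i) (trans (cong suc (ℕ.+-comm j i)) (sym (ℕ.+-suc i j)))) ⟩
        0^ (i + suc j) ++ top ∷ reverse u
          ≡⟨ replicate-++ i (suc j) ⟨
        0^ i ++ 𝟎 ∷ 0^ j ++ top ∷ reverse u
          ≡⟨ cong₂ _++_ (sym (reverse-replicate i 𝟎))
               (cong (𝟎 ∷_) (cong₂ _++_ (sym (reverse-replicate j 𝟎)) (sym (reverse-∷ʳ u top)))) ⟩
        reverse (0^ i) ++ 𝟎 ∷ reverse (0^ j) ++ reverse (u ∷ʳ top) ∎

  -- v contains no run of j zeros (and j ≥ 1); the appended 𝟏 stands for the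
  -- letter in front of v in 0^ j ++ 𝟏 ∷ v ∷ʳ top.
  ShortRuns : ℕ → Str → Set
  ShortRuns j v = ∀ v₁ v₂ t → v₁ ++ v₂ ≡ v → NonzeroWithin j (reverse v₁ ++ 𝟏 ∷ t)

  -- A `direct` reading meets `top` after at most `j` zeros, and `top` exceeds `𝟏`. A `wrapped` one
  -- reads a prefix of `v` backwards into the `𝟏`, so it meets a nonzero letter among its first `j`
  -- letters, or it starts with `top`.
  shortRuns-oriented : ∀ j v → ShortRuns j v → Oriented (0^ j ++ 𝟏 ∷ v ∷ʳ top)
  shortRuns-oriented j v K = ≺-backwards⁻ (0^ j) go
    where
    0^-≺ : ∀ {j i c t} → i ≤ j → 0^ j ++ 𝟏 ∷ c ≺ 0^ i ++ top ∷ t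
    0^-≺ {zero}  z≤n       = here (s≤s (s≤s z≤n))
    0^-≺ {suc j} z≤n       = here (s≤s z≤n)
    0^-≺         (s≤s i≤j) = next (0^-≺ i≤j)

    go : ∀ {r s} → Backwards (0^ j) (v ∷ʳ top) r s → 0^ j ++ 𝟏 ∷ v ∷ʳ top ≺ r ++ 𝟏 ∷ s
    go (direct b₁ b₂ eq) with prefix-replicate j b₁ (sym eq)
    ... | i , i≤j , refl = ≺-respʳ (sym right) (0^-≺ i≤j)
      where
      right : (reverse (0^ i) ++ reverse (v ∷ʳ top)) ++ 𝟏 ∷ reverse b₂
              ≡ 0^ i ++ top ∷ reverse v ++ 𝟏 ∷ reverse b₂
      right = trans (List.++-assoc (reverse (0^ i)) _ _)
        (cong₂ _++_ (reverse-replicate i 𝟎) (cong (_++ _) (reverse-∷ʳ v top)))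
    go (wrapped c₁ c₂ eq) with ++-∷ʳ-split c₁ v (sym eq)
    ... | inj₂ (c₂′ , _ , eq′) = nonzeroWithin-≺ (K c₁ c₂′ _ eq′)
    ... | inj₁ (refl , _) =
      ≺-respʳ (cong (_++ _) (sym (reverse-∷ʳ v top)))
        (nonzeroWithin-≺ (nonzeroWithin-set [] {x = 𝟏} (λ ()) (K [] v [] refl)))

  shortRuns-set : ∀ {j} b {y c} → ShortRuns j (b ++ y ∷ c) → ShortRuns j (b ++ 𝟏 ∷ c)
  shortRuns-set b {y} {c} K v₁ v₂ t eq with ++-∷-split v₁ b eq
  ... | inj₂ (b₁ , b₂ , refl , refl , refl) = K b₁ (b₂ ++ y ∷ c) t (sym (List.++-assoc b₁ _ _))
  ... | inj₁ (c₁ , c₂ , refl , refl , refl) =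
    subst (NonzeroWithin _) (sym (eq′ 𝟏)) (nonzeroWithin-set (reverse c₁) (λ ())
      (subst (NonzeroWithin _) (eq′ y) (K (b ++ y ∷ c₁) c₂ t (List.++-assoc b _ _))))
    where
    eq′ : ∀ z → reverse (b ++ z ∷ c₁) ++ 𝟏 ∷ t ≡ reverse c₁ ++ z ∷ reverse b ++ 𝟏 ∷ t
    eq′ z = trans (cong (_++ _) (reverse-++-∷ b z c₁)) (List.++-assoc (reverse c₁) _ _)

  -- The nonzero letter `y` in front of `w` takes over the role of the appended `𝟏`.
  shortRuns-drop : ∀ {j} e {b y w} → y ≢ 𝟎 → ShortRuns j (b ++ y ∷ w) → ShortRuns (j + e) w
  shortRuns-drop e {b} {y} y≢0 K v₁ v₂ t refl =
    nonzeroWithin-+ e (nonzeroWithin-set (reverse v₁) (λ ())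
      (subst (NonzeroWithin _) (trans (cong (_++ 𝟏 ∷ t) (reverse-++-∷ b y v₁)) (List.++-assoc (reverse v₁) _ _))
        (K (b ++ y ∷ v₁) v₂ t (List.++-assoc b _ _))))

  shortRuns-ones : ∀ j c → ShortRuns (suc j) (replicate c 𝟏)
  shortRuns-ones j c v₁ v₂ t eq with prefix-replicate c v₁ eq
  ... | zero  , _ , refl = here λ ()
  ... | suc i , _ , refl rewrite reverse-replicate {Letter} (suc i) 𝟏 = here λ ()

  -- Reading a prefix of `w` backwards into `x` must exceed `0^ j ++ x ∷ _`. This gives only the
  -- weak bound: runs in `w` may be as long as the initial one. The strict bound comes from
  -- lengthening the initial run.
  oriented-shortRuns : ∀ j {x w} → x ≢ 𝟎 → Oriented (0^ j ++ x ∷ w ∷ʳ top) → ShortRuns (suc j) w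
  oriented-shortRuns j x≢0 o v₁ v₂ t refl =
    nonzeroWithin-set (reverse v₁) (λ ())
      (≺-nonzeroWithin j x≢0 (≺-backwards (0^ j) o (wrapped v₁ (v₂ ∷ʳ top) (List.++-assoc v₁ v₂ [ top ]))))

  -- Paths of one-letter changes to the root.

  record Step (a b : Str) : Set where
    constructor step
    field
      {x y} : Letter
      pre suf : Str
      a≡ : a ≡ pre ++ x ∷ suf
      b≡ : b ≡ pre ++ y ∷ suf
      oa : Oriented a
      ob : Oriented b

  step-sym : ∀ {a b} → Step a b → Step b a
  step-sym (step p s a≡ b≡ oa ob) = step p s b≡ a≡ ob oa

  step-length : ∀ {a b} → Step a b → length a ≡ length b
  step-length (step p s refl refl _ _) = trans (List.length-++ p) (sym (List.length-++ p))

  steps-length : ∀ {a b} → Star Step a b → length a ≡ length b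
  steps-length ε        = refl
  steps-length (s ◅ ss) = trans (step-length s) (steps-length ss)

  -- `p` collects the letters already passed. Writing `𝟏` never lengthens a run of zeros, so every
  -- intermediate string is oriented.
  fill-ones : ∀ j p v → ShortRuns j (p ++ v) →
    Star Step (0^ j ++ 𝟏 ∷ (p ++ v) ∷ʳ top) (0^ j ++ 𝟏 ∷ (p ++ replicate (length v) 𝟏) ∷ʳ top)
  fill-ones j p []      K = ε
  fill-ones j p (y ∷ v) K =
    step (0^ j ++ 𝟏 ∷ p) (v ∷ʳ top) (assoc y) (assoc 𝟏)
      (shortRuns-oriented j _ K) (shortRuns-oriented j _ K′)
    ◅ subst₂ (λ l l′ → Star Step (0^ j ++ 𝟏 ∷ l ∷ʳ top) (0^ j ++ 𝟏 ∷ l′ ∷ʳ top))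
        (List.∷ʳ-++ p 𝟏 v) (List.∷ʳ-++ p 𝟏 _)
        (fill-ones j (p ∷ʳ 𝟏) v (subst (ShortRuns j) (sym (List.∷ʳ-++ p 𝟏 v)) K′))
    where
    K′ = shortRuns-set p K
    assoc : ∀ z → 0^ j ++ 𝟏 ∷ (p ++ z ∷ v) ∷ʳ top ≡ (0^ j ++ 𝟏 ∷ p) ++ z ∷ v ∷ʳ top
    assoc z = trans (cong (λ l → 0^ j ++ 𝟏 ∷ l) (List.++-assoc p (z ∷ v) _)) (sym (List.++-assoc (0^ j) _ _))

  -- The exponent is left existential throughout the paths; since steps preserve length, it is
  -- recovered at the end.
  slide-ones : ∀ j c → ∃ λ j′ →
    Star Step (0^ (suc j) ++ 𝟏 ∷ replicate c 𝟏 ∷ʳ top) (0^ j′ ++ 𝟏 ∷ [ top ])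
  slide-ones j zero    = suc j , ε
  slide-ones j (suc c) with slide-ones (suc j) c
  ... | j′ , ss = j′ ,
    step (0^ (suc j)) (𝟏 ∷ replicate c 𝟏 ∷ʳ top) refl (sym (0^-∷ (suc j)))
      (shortRuns-oriented (suc j) _ (shortRuns-ones j (suc c)))
      (shortRuns-oriented (suc (suc j)) _ (shortRuns-ones (suc j) c))
    ◅ ss

  shortRuns-root : ∀ j v → ShortRuns j v → ∃ λ j′ → Star Step (0^ j ++ 𝟏 ∷ v ∷ʳ top) (0^ j′ ++ 𝟏 ∷ [ top ])
  shortRuns-root zero    v K with () ← K [] v [] refl
  shortRuns-root (suc j) v K with slide-ones j (length v)
  ... | j′ , ss = j′ , (fill-ones (suc j) [] v K ◅◅ ss)

  ToRoot : Str → Set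
  ToRoot a = ∃ λ j → Star Step a (0^ j ++ 𝟏 ∷ [ top ])

  replace : ∀ p {x y s} → Oriented (p ++ x ∷ s) → Oriented (p ++ y ∷ s) →
            ToRoot (p ++ y ∷ s) → ToRoot (p ++ x ∷ s)
  replace p {s = s} ox oy (j , ss) = j , step p s refl refl ox oy ◅ ss

  lower-root : ∀ j {x c} → x ≢ 𝟎 → Oriented (0^ j ++ x ∷ c) →
    (Oriented (0^ j ++ 𝟏 ∷ c) → ToRoot (0^ j ++ 𝟏 ∷ c)) → ToRoot (0^ j ++ x ∷ c)
  lower-root j {x} x≢0 o r with x Fin.≟ 𝟏
  ... | yes refl = r o
  ... | no x≢1   = replace (0^ j) o o′ (r o′)
    where o′ = lower j (λ ()) (1<letter x≢0 x≢1) o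

  -- After the change the initial run has length `suc j + e`, while runs in `w` have length at most
  -- `j`. Once `y` is lowered to `𝟏`, `shortRuns-root` applies.
  lengthen-root : ∀ j e {y w} → y ≢ 𝟎 → y ∷ w ∷ʳ top ≺ top ∷ reverse (y ∷ w) →
    Oriented (0^ j ++ 𝟏 ∷ (0^ e ++ y ∷ w) ∷ʳ top) → ToRoot (0^ j ++ 𝟏 ∷ (0^ e ++ y ∷ w) ∷ʳ top)
  lengthen-root j e {y} {w} y≢0 h o =
    replace (0^ j) o o′
      (subst ToRoot (sym eq) (lower-root (suc j + e) y≢0 (subst Oriented eq o′)
        λ _ → shortRuns-root (suc j + e) w (shortRuns-drop e {0^ e} y≢0 (oriented-shortRuns j (λ ()) o))))
    where
    o′ = lengthen j e (λ ()) y≢0 h o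
    eq : 0^ j ++ 𝟎 ∷ (0^ e ++ y ∷ w) ∷ʳ top ≡ 0^ (suc j + e) ++ y ∷ w ∷ʳ top
    eq = begin
      0^ j ++ 𝟎 ∷ (0^ e ++ y ∷ w) ∷ʳ top   ≡⟨ 0^-∷ j ⟩
      0^ (suc j) ++ (0^ e ++ y ∷ w) ∷ʳ top ≡⟨ cong (0^ (suc j) ++_) (List.++-assoc (0^ e) _ _) ⟩
      0^ (suc j) ++ 0^ e ++ y ∷ w ∷ʳ top   ≡⟨ replicate-++ (suc j) e ⟩
      0^ (suc j + e) ++ y ∷ w ∷ʳ top       ∎
      where open ≡-Reasoning

  -- Stated negatively so as to include the empty string, which occurs for `0^ j ++ 𝟏 ∷ [ top ]`.
  NonzeroLast : Str → Set
  NonzeroLast w = ∀ u → w ≢ u ∷ʳ 𝟎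

  nonzeroLast-suffix : ∀ p {w} → NonzeroLast (p ++ w) → NonzeroLast w
  nonzeroLast-suffix p nz u refl = nz (p ++ u) (sym (List.++-assoc p u _))

  strip-zeros : ∀ l → (∃ λ e → l ≡ 0^ e) ⊎ (∃ λ e → ∃₂ λ y w → y ≢ 𝟎 × l ≡ 0^ e ++ y ∷ w)
  strip-zeros []      = inj₁ (0 , refl)
  strip-zeros (Fin.suc i ∷ l) = inj₂ (0 , Fin.suc i , l , (λ ()) , refl)
  strip-zeros (𝟎 ∷ l) with strip-zeros l
  ... | inj₁ (e , refl)               = inj₁ (suc e , refl)
  ... | inj₂ (e , y , w , y≢0 , refl) = inj₂ (suc e , y , w , y≢0 , refl)

  -- This is the hypothesis of `lengthen` for `y ≡ top`. Behind the common `top`, if `j` is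
  -- positive, the left side has `𝟎` and the right side the nonzero last letter of `0^ j ++ t`. If
  -- `j` is zero, the whole string starts with `𝟏`: orientation then excludes a positive `e`, and
  -- for `e ≡ 0` the reading backwards from that `𝟏` is the claim.
  top-prefix-≺ : ∀ j e t → NonzeroLast (0^ j ++ t) →
    Oriented (0^ j ++ 𝟏 ∷ (0^ e ++ top ∷ 0^ j ++ t) ∷ʳ top) →
    top ∷ (0^ j ++ t) ∷ʳ top ≺ top ∷ reverse (top ∷ 0^ j ++ t)
  top-prefix-≺ zero    zero    t nz o =
    ++-≺⁻ [ 𝟏 ] (≺-respʳ (cong (𝟏 ∷_) (reverse-∷ʳ (top ∷ t) top)) (o [ 𝟏 ] _ refl))
  top-prefix-≺ zero    (suc e) t nz o with o (𝟏 ∷ 𝟎 ∷ []) _ refl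
  ... | here ()
  top-prefix-≺ (suc j) e       t nz o with initLast t
  ... | [] = contradiction (trans (List.++-identityʳ (0^ (suc j))) (sym (replicate-∷ʳ j 𝟎))) (nz (0^ j))
  ... | t′ ∷ʳ′ z =
    next (≺-respʳ (sym (trans (cong reverse assoc) (reverse-∷ʳ (top ∷ 0^ (suc j) ++ t′) z))) (here (0<letter z≢0)))
    where
    assoc : top ∷ 0^ (suc j) ++ t′ ∷ʳ z ≡ (top ∷ 0^ (suc j) ++ t′) ∷ʳ z
    assoc = cong (top ∷_) (sym (List.++-assoc (0^ (suc j)) t′ _))
    z≢0 : z ≢ 𝟎
    z≢0 refl = nz (0^ (suc j) ++ t′) (List.∷-injectiveʳ assoc)

  normal-root : ∀ j w → NonzeroLast w → Oriented (0^ j ++ 𝟏 ∷ w ∷ʳ top) → ToRoot (0^ j ++ 𝟏 ∷ w ∷ʳ top)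
  normal-root j w nz o with strip-zeros w
  ... | inj₁ (zero , refl) = j , ε
  ... | inj₁ (suc e , refl) = contradiction (sym (replicate-∷ʳ e 𝟎)) (nz (0^ e))
  ... | inj₂ (e , y , v , y≢0 , refl) with y Fin.≟ top
  ...   | no y≢top = lengthen-root j e y≢0 (here (≢top⇒<top y≢top)) o
  ...   | yes refl with prefix? (0^ j) v
  ...     | yes (t , refl) =
      lengthen-root j e y≢0 (top-prefix-≺ j e t (nonzeroLast-suffix [ top ] (nonzeroLast-suffix (0^ e) nz)) o) o
  ...     | no ¬prefix = subst ToRoot (assoc top)
      (replace (0^ j ++ 𝟏 ∷ 0^ e) (subst Oriented (sym (assoc top)) o) o′
        -- With `𝟏` in place of `y`, the hypothesis of `lengthen` is decided by `𝟏 < top`.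
        (subst ToRoot (sym (assoc 𝟏)) (lengthen-root j e (λ ()) (here (s≤s (s≤s z≤n))) (subst Oriented (assoc 𝟏) o′))))
    where
    assoc : ∀ z → (0^ j ++ 𝟏 ∷ 0^ e) ++ z ∷ v ∷ʳ top ≡ 0^ j ++ 𝟏 ∷ (0^ e ++ z ∷ v) ∷ʳ top
    assoc z = trans (List.++-assoc (0^ j) _ _) (cong (λ l → 0^ j ++ 𝟏 ∷ l) (sym (List.++-assoc (0^ e) _ _)))
    o′ = lower-second j e (s≤s (s≤s z≤n)) ¬prefix (subst Oriented (sym (assoc top)) o)

  -- The first nonzero letter `y` may be `z` itself; then `w` is empty.
  raised-root : ∀ b z → z ≢ 𝟎 → Oriented ((b ∷ʳ z) ∷ʳ top) → ToRoot ((b ∷ʳ z) ∷ʳ top)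
  raised-root b z z≢0 o with strip-zeros (b ∷ʳ z)
  ... | inj₁ (e , eq) = contradiction (∈-replicate⇒≡ e b eq) z≢0
  ... | inj₂ (e , y , w , y≢0 , eq) =
    subst ToRoot (sym assoc)
      (lower-root e y≢0 (subst Oriented assoc o)
        (normal-root e w (nonzeroLast-suffix [ y ] (nonzeroLast-suffix (0^ e) nz))))
    where
    assoc : (b ∷ʳ z) ∷ʳ top ≡ 0^ e ++ y ∷ w ∷ʳ top
    assoc = trans (cong (_∷ʳ top) eq) (List.++-assoc (0^ e) _ _)
    nz : NonzeroLast (0^ e ++ y ∷ w)
    nz u eq′ = z≢0 (List.∷ʳ-injectiveʳ b u (trans eq eq′))

  top-last-root : ∀ c b z → Oriented (((c ∷ b) ∷ʳ z) ∷ʳ top) → ToRoot (((c ∷ b) ∷ʳ z) ∷ʳ top)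
  top-last-root c b (Fin.suc i) o = raised-root (c ∷ b) (Fin.suc i) (λ ()) o
  top-last-root c b 𝟎 o =
    subst ToRoot (sym (assoc 𝟎))
      (replace (c ∷ b) (subst Oriented (assoc 𝟎) o) o′
        (subst ToRoot (assoc 𝟏) (raised-root (c ∷ b) 𝟏 (λ ()) (subst Oriented (sym (assoc 𝟏)) o′))))
    where
    assoc : ∀ z → ((c ∷ b) ∷ʳ z) ∷ʳ top ≡ (c ∷ b) ++ z ∷ [ top ]
    assoc z = List.∷ʳ-++ (c ∷ b) z [ top ]
    o′ = raise-second-last c b (subst Oriented (assoc 𝟎) o)

  oriented-root : ∀ a → 3 ≤ length a → Oriented a → ToRoot a
  oriented-root a 3≤ o with initLast a
  ... | b ∷ʳ′ x with initLast b
  oriented-root _ (s≤s ()) o | _ ∷ʳ′ x | []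
  oriented-root _ (s≤s (s≤s ())) o | _ ∷ʳ′ x | [] ∷ʳ′ z
  oriented-root _ _ o | _ ∷ʳ′ x | (c ∷ b) ∷ʳ′ z with x Fin.≟ top
  ... | yes refl = top-last-root c b z o
  ... | no x≢top = replace ((c ∷ b) ∷ʳ z) o o′ (top-last-root c b z o′)
    where o′ = raise-last ((c ∷ b) ∷ʳ z) (≢top⇒<top x≢top) o

-- Arithmetic of remainders.

toℕ-mod : ∀ i n .{{_ : ℕ.NonZero n}} → toℕ (i mod n) ≡ i % n
toℕ-mod i n = Fin.toℕ-fromℕ< (m%n<n i n)

mod-cong : ∀ i j n .{{_ : ℕ.NonZero n}} → i % n ≡ j % n → i mod n ≡ j mod n
mod-cong i j n eq = Fin.toℕ-injective (trans (toℕ-mod i n) (trans eq (sym (toℕ-mod j n))))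

mod-toℕ : ∀ {n} (t : Fin (suc n)) → toℕ t mod suc n ≡ t
mod-toℕ {n} t = Fin.toℕ-injective (trans (toℕ-mod (toℕ t) (suc n)) (m<n⇒m%n≡m (Fin.toℕ<n t)))

%-+ʳ : ∀ i j n .{{_ : ℕ.NonZero n}} → (i + j % n) % n ≡ (i + j) % n
%-+ʳ i j n = begin
  (i + j % n) % n         ≡⟨ %-distribˡ-+ i (j % n) n ⟩
  (i % n + j % n % n) % n ≡⟨ cong (λ x → (i % n + x) % n) (m%n%n≡m%n j n) ⟩
  (i % n + j % n) % n     ≡⟨ %-distribˡ-+ i j n ⟨
  (i + j) % n             ∎
  where open ≡-Reasoning

%-+ˡ : ∀ i j n .{{_ : ℕ.NonZero n}} → (i % n + j) % n ≡ (i + j) % n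
%-+ˡ i j n = begin
  (i % n + j) % n ≡⟨ cong (_% n) (ℕ.+-comm (i % n) j) ⟩
  (j + i % n) % n ≡⟨ %-+ʳ j i n ⟩
  (j + i) % n     ≡⟨ cong (_% n) (ℕ.+-comm j i) ⟩
  (i + j) % n     ∎
  where open ≡-Reasoning

-- Rotations

module _ {A : Set} where
  open import Data.Vec.Base using (_∷ʳ_)

  rotate₁ : ∀ {n} → Vec A n → Vec A n
  rotate₁ []       = []
  rotate₁ (x ∷ xs) = xs ∷ʳ x

  rotate : ∀ {n} → ℕ → Vec A n → Vec A n
  rotate zero    w = w
  rotate (suc i) w = rotate₁ (rotate i w)

  rotate-+ : ∀ {n} i j (w : Vec A n) → rotate (i + j) w ≡ rotate i (rotate j w)
  rotate-+ zero    j w = refl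
  rotate-+ (suc i) j w = cong rotate₁ (rotate-+ i j w)

  lookup-∷ʳ-fromℕ : ∀ {n} (xs : Vec A n) x → lookup (xs ∷ʳ x) (fromℕ n) ≡ x
  lookup-∷ʳ-fromℕ []       x = refl
  lookup-∷ʳ-fromℕ (_ ∷ xs) x = lookup-∷ʳ-fromℕ xs x

  lookup-∷ʳ-inject₁ : ∀ {n} (xs : Vec A n) x i → lookup (xs ∷ʳ x) (inject₁ i) ≡ lookup xs i
  lookup-∷ʳ-inject₁ (_ ∷ xs) x Fin.zero    = refl
  lookup-∷ʳ-inject₁ (_ ∷ xs) x (Fin.suc i) = lookup-∷ʳ-inject₁ xs x i

  lookup-rotate₁ : ∀ {n} (w : Vec A (suc n)) j → lookup (rotate₁ w) j ≡ lookup w (suc (toℕ j) mod suc n)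
  lookup-rotate₁ {n} (x ∷ xs) j with view j
  ... | ‵fromℕ     = trans (lookup-∷ʳ-fromℕ xs x) (cong (lookup (x ∷ xs)) (sym eq))
    where
    eq : suc (toℕ (fromℕ n)) mod suc n ≡ Fin.zero
    eq = Fin.toℕ-injective (trans (toℕ-mod (suc (toℕ (fromℕ n))) (suc n))
           (trans (cong (λ i → suc i % suc n) (Fin.toℕ-fromℕ n)) (n%n≡0 (suc n))))
  ... | ‵inject₁ i = trans (lookup-∷ʳ-inject₁ xs x i) (cong (lookup (x ∷ xs)) (sym eq))
    where
    eq : suc (toℕ (inject₁ i)) mod suc n ≡ Fin.suc i
    eq = trans (cong (λ m → suc m mod suc n) (Fin.toℕ-inject₁ i)) (mod-toℕ (Fin.suc i))

  lookup-rotate : ∀ {n} i (w : Vec A (suc n)) j → lookup (rotate i w) j ≡ lookup w ((i + toℕ j) mod suc n)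
  lookup-rotate {n} zero    w j = cong (lookup w) (sym (mod-toℕ j))
  lookup-rotate {n} (suc i) w j = begin
    lookup (rotate₁ (rotate i w)) j                        ≡⟨ lookup-rotate₁ (rotate i w) j ⟩
    lookup (rotate i w) (suc (toℕ j) mod suc n)            ≡⟨ lookup-rotate i w _ ⟩
    lookup w ((i + toℕ (suc (toℕ j) mod suc n)) mod suc n)
      ≡⟨ cong (lookup w) (mod-cong (i + toℕ (suc (toℕ j) mod suc n)) (suc i + toℕ j) (suc n) eq) ⟩
    lookup w ((suc i + toℕ j) mod suc n)                   ∎
    where
    open ≡-Reasoning
    eq : (i + toℕ (suc (toℕ j) mod suc n)) % suc n ≡ (suc i + toℕ j) % suc n
    eq = trans (cong (λ m → (i + m) % suc n) (toℕ-mod (suc (toℕ j)) (suc n)))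
          (trans (%-+ʳ i (suc (toℕ j)) (suc n)) (cong (_% suc n) (ℕ.+-suc i (toℕ j))))

  lookup-ext : ∀ {n} {v w : Vec A n} → (∀ j → lookup v j ≡ lookup w j) → v ≡ w
  lookup-ext {v = v} {w} h = trans (sym (Vec.tabulate∘lookup v)) (trans (Vec.tabulate-cong h) (Vec.tabulate∘lookup w))

  -- The bridge from windows, indexed by `Fin`, to iterated rotation with arbitrary exponents.
  window-mod : ∀ {n} (w : Vec A (suc n)) i → window w (suc n) (i mod suc n) ≡ rotate i w
  window-mod {n} w i = lookup-ext λ j → begin
    lookup (window w (suc n) (i mod suc n)) j
      ≡⟨ Vec.lookup∘tabulate (λ j → lookup w ((toℕ (i mod suc n) + toℕ j) mod suc n)) j ⟩
    lookup w ((toℕ (i mod suc n) + toℕ j) mod suc n)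
      ≡⟨ cong (lookup w) (mod-cong (toℕ (i mod suc n) + toℕ j) (i + toℕ j) (suc n) (eq j)) ⟩
    lookup w ((i + toℕ j) mod suc n)                 ≡⟨ lookup-rotate i w j ⟨
    lookup (rotate i w) j                            ∎
    where
    open ≡-Reasoning
    eq : ∀ j → (toℕ (i mod suc n) + toℕ j) % suc n ≡ (i + toℕ j) % suc n
    eq j = trans (cong (λ m → (m + toℕ j) % suc n) (toℕ-mod i (suc n))) (%-+ˡ i (toℕ j) (suc n))

  window-rotate : ∀ {n} (w : Vec A (suc n)) t → window w (suc n) t ≡ rotate (toℕ t) w
  window-rotate {n} w t = trans (cong (window w (suc n)) (sym (mod-toℕ t))) (window-mod w (toℕ t))

  rotate-full : ∀ {n} (w : Vec A (suc n)) → rotate (suc n) w ≡ w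
  rotate-full {n} w = lookup-ext λ j → trans (lookup-rotate (suc n) w j) (cong (lookup w) (begin
    (suc n + toℕ j) mod suc n ≡⟨ cong (_mod suc n) (ℕ.+-comm (suc n) (toℕ j)) ⟩
    (toℕ j + suc n) mod suc n ≡⟨ mod-cong (toℕ j + suc n) (toℕ j) (suc n) ([m+n]%n≡m%n (toℕ j) (suc n)) ⟩
    toℕ j mod suc n           ≡⟨ mod-toℕ j ⟩
    j                         ∎))
    where open ≡-Reasoning

  rotate-*-full : ∀ {n} i (w : Vec A (suc n)) → rotate (i * suc n) w ≡ w
  rotate-*-full zero    w = refl
  rotate-*-full {n} (suc i) w =
    trans (rotate-+ (suc n) (i * suc n) w) (trans (rotate-full _) (rotate-*-full i w))

  infix 4 _≈_
  -- With unbounded exponents, transitivity is just addition.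
  _≈_ : ∀ {n} → Vec A n → Vec A n → Set
  v ≈ w = ∃ λ i → rotate i v ≡ w

  ≈-trans : ∀ {n} {u v w : Vec A n} → u ≈ v → v ≈ w → u ≈ w
  ≈-trans {u = u} (i , refl) (j , refl) = j + i , rotate-+ j i u

  ≈-sym : ∀ {n} {v w : Vec A (suc n)} → v ≈ w → w ≈ v
  -- Another `i * n` rotations complete `i` full turns of length `suc n`.
  ≈-sym {n} {v} (i , refl) = i * n , (begin
    rotate (i * n) (rotate i v) ≡⟨ rotate-+ (i * n) i v ⟨
    rotate (i * n + i) v        ≡⟨ cong (λ m → rotate m v) (trans (ℕ.+-comm (i * n) i) (sym (ℕ.*-suc i n))) ⟩
    rotate (i * suc n) v        ≡⟨ rotate-*-full i v ⟩
    v                           ∎)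
    where open ≡-Reasoning

  -- Reversal conjugates rotation to its inverse.
  rotate₁-reverse : ∀ {n} (w : Vec A n) → rotate₁ (Vec.reverse (rotate₁ w)) ≡ Vec.reverse w
  rotate₁-reverse []       = refl
  rotate₁-reverse (x ∷ xs) = trans (cong rotate₁ (reverse-snoc xs)) (sym (Vec.reverse-∷ x xs))
    where
    reverse-snoc : ∀ {n} (xs : Vec A n) → Vec.reverse (xs ∷ʳ x) ≡ x ∷ Vec.reverse xs
    reverse-snoc []       = refl
    reverse-snoc (y ∷ xs) = begin
      Vec.reverse (y ∷ (xs ∷ʳ x)) ≡⟨ Vec.reverse-∷ y (xs ∷ʳ x) ⟩
      Vec.reverse (xs ∷ʳ x) ∷ʳ y  ≡⟨ cong (_∷ʳ y) (reverse-snoc xs) ⟩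
      x ∷ (Vec.reverse xs ∷ʳ y)   ≡⟨ cong (x ∷_) (Vec.reverse-∷ y xs) ⟨
      x ∷ Vec.reverse (y ∷ xs)    ∎
      where open ≡-Reasoning

  ≈-reverse : ∀ {n} {v w : Vec A (suc n)} → v ≈ w → Vec.reverse v ≈ Vec.reverse w
  ≈-reverse {v = v} (i , refl) = ≈-sym (go i)
    where
    go : ∀ i → Vec.reverse (rotate i v) ≈ Vec.reverse v
    go zero    = 0 , refl
    go (suc i) = ≈-trans (1 , rotate₁-reverse (rotate i v)) (go i)

  toList-rotate : ∀ {n} (w : Vec A n) u v → toList w ≡ u ++ v → toList (rotate (length u) w) ≡ v ++ u
  toList-rotate w        []      v eq = trans eq (sym (List.++-identityʳ v))
  toList-rotate (y ∷ ys) (x ∷ u) v eq with List.∷-injective eq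
  ... | refl , eq′ = begin
    toList (rotate (suc (length u)) (x ∷ ys))
      ≡⟨ cong (λ i → toList (rotate i (x ∷ ys))) (ℕ.+-comm 1 (length u)) ⟩
    toList (rotate (length u + 1) (x ∷ ys))
      ≡⟨ cong toList (rotate-+ (length u) 1 (x ∷ ys)) ⟩
    toList (rotate (length u) (ys ∷ʳ x))
      ≡⟨ toList-rotate (ys ∷ʳ x) u (v List.∷ʳ x) (begin
           toList (ys ∷ʳ x)    ≡⟨ Vec.toList-∷ʳ x ys ⟩
           toList ys List.∷ʳ x ≡⟨ cong (List._∷ʳ x) eq′ ⟩
           (u ++ v) List.∷ʳ x  ≡⟨ List.++-assoc u v _ ⟩
           u ++ v List.∷ʳ x    ∎) ⟩
    (v List.∷ʳ x) ++ u
      ≡⟨ List.∷ʳ-++ v x u ⟩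
    v ++ x ∷ u ∎
    where open ≡-Reasoning

  rotate-split : ∀ {n} i (w : Vec A (suc n)) → ∃₂ λ u v → toList w ≡ u ++ v × toList (rotate i w) ≡ v ++ u
  rotate-split {n} i w = u , v , sym take++drop , (begin
    toList (rotate i w)          ≡⟨ cong toList (window-mod w i) ⟨
    toList (window w (suc n) t)  ≡⟨ cong toList (window-rotate w t) ⟩
    toList (rotate (toℕ t) w)    ≡⟨ cong (λ i → toList (rotate i w)) length-u ⟨
    toList (rotate (length u) w) ≡⟨ toList-rotate w u v (sym take++drop) ⟩
    v ++ u                       ∎)
    where
    open ≡-Reasoning
    -- Reducing the exponent puts the cut inside the word, so `u` has length exactly `toℕ t`.
    t = i mod suc n
    u = List.take (toℕ t) (toList w)
    v = List.drop (toℕ t) (toList w)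
    take++drop = List.take++drop≡id (toℕ t) (toList w)
    length-u : length u ≡ toℕ t
    length-u = trans (List.length-take (toℕ t) (toList w))
      (ℕ.m≤n⇒m⊓n≡m (subst (toℕ t ≤_) (sym (Vec.length-toList w)) (ℕ.<⇒≤ (Fin.toℕ<n t))))

  toList-injective : ∀ {n} {v w : Vec A n} → toList v ≡ toList w → v ≡ w
  toList-injective {v = v} {w} eq = trans (sym (Vec.cast-is-id refl v)) (Vec.toList-injective refl v w eq)

-- Rotation classes and the lexicographic order.

module _ {k n : ℕ} where

  rotations⇒≈ : ∀ {α β : Word k (suc n)} → Rotations α β → α ≈ β
  rotations⇒≈ {α} (t , refl) = toℕ t , sym (window-rotate α t)

  ≈⇒rotations : ∀ {α β : Word k (suc n)} → α ≈ β → Rotations α β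
  ≈⇒rotations {α} (i , refl) = i mod suc n , sym (window-mod α i)

  ≤ₗ-trans : ∀ {α β γ : Word k n} → α ≤ₗ β → β ≤ₗ γ → α ≤ₗ γ
  ≤ₗ-trans = Lex.≤-trans (IsEquivalence.isPartialEquivalence isEquivalence) (resp₂ Fin._<_) Fin.<-trans

  ≤ₗ-total : ∀ (α β : Word k n) → α ≤ₗ β ⊎ β ≤ₗ α
  ≤ₗ-total = Lex.≤-total sym Fin.<-cmp

least-member : ∀ {k n m} (f : Fin (suc m) → Word k n) → ∃ λ t → ∀ i → f t ≤ₗ f i
least-member {m = zero}  f = Fin.zero , λ { Fin.zero → Lex.≤-refl (Pointwise.refl refl) }
least-member {m = suc m} f with least-member (f ∘ Fin.suc)
... | t , h with ≤ₗ-total (f Fin.zero) (f (Fin.suc t))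
...   | inj₁ p = Fin.zero , λ { Fin.zero → Lex.≤-refl (Pointwise.refl refl) ; (Fin.suc i) → ≤ₗ-trans p (h i) }
...   | inj₂ p = Fin.suc t , λ { Fin.zero → p ; (Fin.suc i) → h i }

-- Oriented strings and the set `𝐒`.

module _ {k : ℕ} where
  open Oriented {k}

  ≤ₗ⇒≡⊎≺ : ∀ {n} {α β : Word (3 + k) n} → α ≤ₗ β → α ≡ β ⊎ toList α ≺ toList β
  ≤ₗ⇒≡⊎≺ (base _)       = inj₁ refl
  ≤ₗ⇒≡⊎≺ (this x<y _)   = inj₂ (here x<y)
  ≤ₗ⇒≡⊎≺ {α = x ∷ _} (next refl p) with ≤ₗ⇒≡⊎≺ p
  ... | inj₁ eq = inj₁ (cong (x ∷_) eq)
  ... | inj₂ q  = inj₂ (next q)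

  ≺⇒≤ₗ : ∀ {n} {α β : Word (3 + k) n} → toList α ≺ toList β → α ≤ₗ β
  ≺⇒≤ₗ {α = _ ∷ _} {_ ∷ _} (here x<y) = this x<y refl
  ≺⇒≤ₗ {α = _ ∷ _} {_ ∷ _} (next p)   = next refl (≺⇒≤ₗ p)

  BelowReversals : ∀ {n} → Word (3 + k) n → Set
  BelowReversals w = ∀ {β} → Vec.reverse w ≈ β → toList w ≺ toList β

  belowReversals⇒oriented : ∀ {n} (w : Word (3 + k) n) → BelowReversals w → Oriented (toList w)
  belowReversals⇒oriented w below u v eq =
    ≺-respʳ (toList-rotate (Vec.reverse w) (List.reverse v) (List.reverse u)
        (trans (Vec.toList-reverse w) (trans (cong List.reverse (sym eq)) (List.reverse-++ u v))))
      (below (length (List.reverse v) , refl))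

  oriented⇒belowReversals : ∀ {n} (w : Word (3 + k) (suc n)) → Oriented (toList w) → BelowReversals w
  oriented⇒belowReversals w o (i , refl) with rotate-split i (Vec.reverse w)
  ... | p , q , eq , eq′ =
    ≺-respʳ (trans (cong₂ _++_ (List.reverse-involutive q) (List.reverse-involutive p)) (sym eq′))
      (o (List.reverse q) (List.reverse p) (begin
        List.reverse q ++ List.reverse p       ≡⟨ List.reverse-++ p q ⟨
        List.reverse (p ++ q)                  ≡⟨ cong List.reverse eq ⟨
        List.reverse (toList (Vec.reverse w))  ≡⟨ cong List.reverse (Vec.toList-reverse w) ⟩
        List.reverse (List.reverse (toList w)) ≡⟨ List.reverse-involutive (toList w) ⟩
        toList w                               ∎))
    where open ≡-Reasoning

  -- Bracelets give the weak inequality; equality would make the reversal a rotation of `α`, against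
  -- asymmetry.
  𝐀⇒belowReversals : ∀ {n} {α : Word (3 + k) (suc n)} → 𝐀 (3 + k) (suc n) α → BelowReversals α
  𝐀⇒belowReversals ((_ , min) , (_ , asym)) r with ≤ₗ⇒≡⊎≺ (min _ (inj₂ (≈⇒rotations r)))
  ... | inj₁ refl = contradiction (≈⇒rotations (≈-sym r)) asym
  ... | inj₂ p    = p

  -- The least rotation `α` of `w` is the required bracelet: it is at most `w`, hence below all
  -- rotations of its reversal. If `α` were symmetric, `w` would be a rotation of its own reversal
  -- and so precede itself.
  belowReversals⇒𝐒 : ∀ {n} (w : Word (3 + k) (suc n)) → BelowReversals w → 𝐒 (3 + k) (suc n) w
  belowReversals⇒𝐒 {n} w below with least-member (window w (suc n))
  ... | t , h = α , (((inj₁ self) , λ { β (inj₁ r) → α-min (rotations⇒≈ r)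
                                     ; β (inj₂ r) → α-below (rotations⇒≈ r) })
                     , (self , λ β r → α-min (rotations⇒≈ r)) , asym) , ≈⇒rotations (≈-sym w≈α)
    where
    α = window w (suc n) t
    w≈α : w ≈ α
    w≈α = rotations⇒≈ (t , refl)
    self : Rotations α α
    self = ≈⇒rotations (0 , refl)
    α-min : ∀ {β} → α ≈ β → α ≤ₗ β
    α-min r with ≈⇒rotations (≈-trans w≈α r)
    ... | i , refl = h i
    α-below : ∀ {β} → Vec.reverse α ≈ β → α ≤ₗ β
    α-below r = ≤ₗ-trans (α-min (≈-sym w≈α)) (≺⇒≤ₗ (below (≈-trans (≈-reverse w≈α) r)))
    asym : ¬ Rotations α (Vec.reverse α)
    asym r = ≺-irrefl (below (≈-trans (≈-reverse w≈α)
      (≈-trans (≈-sym (rotations⇒≈ r)) (≈-sym w≈α))))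

  𝐒-≈ : ∀ {n} {v w : Word (3 + k) (suc n)} → v ≈ w → 𝐒 (3 + k) (suc n) v → 𝐒 (3 + k) (suc n) w
  𝐒-≈ v≈w (α , α∈ , r) = α , α∈ , ≈⇒rotations (≈-trans (rotations⇒≈ {α = α} r) v≈w)

  -- The two bracelets would be rotations of each other's reversals, so each would strictly precede
  -- the other.
  𝐒-reverse : ∀ {n} {w : Word (3 + k) (suc n)} → 𝐒 (3 + k) (suc n) w → ¬ 𝐒 (3 + k) (suc n) (Vec.reverse w)
  𝐒-reverse {w = w} (α , α∈ , r) (α′ , α′∈ , r′) =
    ≺-irrefl (≺-trans (𝐀⇒belowReversals α∈ ᾱ≈α′) (𝐀⇒belowReversals α′∈ ᾱ′≈α))
    where
    ᾱ≈α′ : Vec.reverse α ≈ α′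
    ᾱ≈α′ = ≈-trans (≈-reverse (rotations⇒≈ {α = α} r)) (≈-sym (rotations⇒≈ {α = α′} r′))
    ᾱ′≈α : Vec.reverse α′ ≈ α
    ᾱ′≈α = ≈-sym (subst (_≈ Vec.reverse α′) (Vec.reverse-involutive α) (≈-reverse ᾱ≈α′))

-- Closed walks

lookup-injective : ∀ {A : Set} {xs : List A} → Unique xs → ∀ {i j} → List.lookup xs i ≡ List.lookup xs j → i ≡ j
lookup-injective (_   ∷ _) {Fin.zero}  {Fin.zero}  eq = refl
lookup-injective (x∉ ∷ _) {Fin.zero}  {Fin.suc j} eq = contradiction eq (All.lookup x∉ (∈.∈-lookup j))
lookup-injective (x∉ ∷ _) {Fin.suc i} {Fin.zero}  eq = contradiction (sym eq) (All.lookup x∉ (∈.∈-lookup i))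
lookup-injective (_   ∷ u) {Fin.suc i} {Fin.suc j} eq = cong Fin.suc (lookup-injective u eq)

unique-⊆⇒length≤ : ∀ {A : Set} {xs ys : List A} → Unique xs → xs ⊆ ys → length xs ≤ length ys
unique-⊆⇒length≤ {xs = xs} {ys} u xs⊆ys = Fin.injective⇒≤ {f = f} λ {i} {j} eq →
  lookup-injective u (trans (f-lookup i) (trans (cong (List.lookup ys) eq) (sym (f-lookup j))))
  where
  f : Fin (length xs) → Fin (length ys)
  f i = Any.index (xs⊆ys (∈.∈-lookup i))
  f-lookup : ∀ i → List.lookup xs i ≡ List.lookup ys (f i)
  f-lookup i = Any.lookup-index (xs⊆ys (∈.∈-lookup {xs = xs} i))

least : ∀ {P : Pred ℕ 0ℓ} → Decidable P → ∀ n → P n → ∃ λ m → P m × (∀ {i} → i < m → ¬ P i)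
least P? zero    p = 0 , p , λ ()
least P? (suc n) p with P? 0
... | yes p₀ = 0 , p₀ , λ ()
... | no ¬p₀ with least (P? ∘ suc) n p
...   | m , pm , min = suc m , pm , λ { {zero} _ → ¬p₀ ; {suc i} (s≤s i<m) → min i<m }

module Walks {A : Set} {n : ℕ} where

  infix 4 _↝_
  -- The edges of the de Bruijn graph.
  _↝_ : Vec A (suc n) → Vec A (suc n) → Set
  v ↝ w = ∀ j → lookup v (Fin.suc j) ≡ lookup w (inject₁ j)

  ↝-rotate₁ : ∀ w → w ↝ rotate₁ w
  ↝-rotate₁ (x ∷ xs) j = sym (lookup-∷ʳ-inject₁ xs x j)

  -- The list holds the inner vertices only, so for a closed walk `v ∷ vs` records each visit once.
  data Walk : Vec A (suc n) → List (Vec A (suc n)) → Vec A (suc n) → Set where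
    last : ∀ {v w} → v ↝ w → Walk v [] w
    _∷_  : ∀ {u v vs w} → u ↝ v → Walk v vs w → Walk u (v ∷ vs) w

  walk-++ : ∀ {u vs v ws w} → Walk u vs v → Walk v ws w → Walk u (vs ++ v ∷ ws) w
  walk-++ (last p) q = p ∷ q
  walk-++ (p ∷ ps) q = p ∷ walk-++ ps q

  walk-tail : ∀ {x y α vs w} → Walk (x ∷ α) vs w → Walk (y ∷ α) vs w
  walk-tail (last p) = last p
  walk-tail (p ∷ ps) = p ∷ ps

  -- Since x ∷ α and y ∷ α have the same successors, a closed walk through
  -- one can be spliced into a walk through the other.
  splice : ∀ {x y α ds v vs w} → Walk (y ∷ α) ds (y ∷ α) → x ∷ α ∈ v ∷ vs → Walk v vs w →
    ∃ λ us → Walk v us w × v ∷ us ↭ ((y ∷ α) ∷ ds) ++ v ∷ vs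
  splice {x} {y} {α} {ds} {v} {vs} d (here refl) p =
    -- From `x ∷ α` the walk enters the cycle at the successor of `y ∷ α`, closes it at `y ∷ α`, and
    -- leaves as it would have left `x ∷ α`.
    ds ++ (y ∷ α) ∷ vs , walk-++ (walk-tail d) (walk-tail p) ,
    ↭-trans (prep (x ∷ α) (↭.shift (y ∷ α) ds vs))
      (↭-trans (swap (x ∷ α) (y ∷ α) ↭-refl) (prep (y ∷ α) (↭-sym (↭.shift (x ∷ α) ds vs))))
  splice {y = y} {α} {ds} {v = v} {vs} d (there x∈) (p ∷ ps) with splice d x∈ ps
  ... | us , q , perm = _ ∷ us , p ∷ q , ↭-trans (prep v perm) (↭-sym (↭.shift v ((y ∷ α) ∷ ds) vs))

  walk-applyUpTo : ∀ (f : ℕ → Vec A (suc n)) → (∀ i → f i ↝ f (suc i)) → ∀ m →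
    Walk (f 0) (applyUpTo (f ∘ suc) m) (f (suc m))
  walk-applyUpTo f h zero    = last (h 0)
  walk-applyUpTo f h (suc m) = h 0 ∷ walk-applyUpTo (f ∘ suc) (h ∘ suc) m

  -- Past the end of the list, the value is w.
  at : List (Vec A (suc n)) → Vec A (suc n) → ℕ → Vec A (suc n)
  at []       w _       = w
  at (v ∷ vs) w zero    = v
  at (v ∷ vs) w (suc t) = at vs w t

  at-length : ∀ vs w → at vs w (length vs) ≡ w
  at-length []       w = refl
  at-length (v ∷ vs) w = at-length vs w

  at-lookup : ∀ vs w t → at vs w (toℕ t) ≡ List.lookup vs t
  at-lookup (v ∷ vs) w Fin.zero    = refl
  at-lookup (v ∷ vs) w (Fin.suc t) = at-lookup vs w t

  at-↝ : ∀ {v vs w t} → Walk v vs w → t < suc (length vs) → at (v ∷ vs) w t ↝ at (v ∷ vs) w (suc t)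
  at-↝ {t = zero}  (last p) _         = p
  at-↝ {t = zero}  (p ∷ _)  _         = p
  at-↝ {t = suc t} (last _) (s≤s ())
  at-↝ {t = suc t} (_ ∷ ps) (s≤s t<)  = at-↝ ps t<

  module _ {v vs} (walk : Walk v vs v) where
    private
      L = suc (length vs)

    vertex : ℕ → Vec A (suc n)
    vertex t = at (v ∷ vs) v (t % L)

    vertex-↝ : ∀ t → vertex t ↝ vertex (suc t)
    vertex-↝ t = subst (vertex t ↝_) (next≡ (ℕ.m≤n⇒m<n∨m≡n (m%n<n t L))) (at-↝ walk (m%n<n t L))
      where
      suc-% : suc t % L ≡ suc (t % L) % L
      suc-% = sym (%-+ʳ 1 t L)
      next≡ : suc (t % L) < L ⊎ suc (t % L) ≡ L → at (v ∷ vs) v (suc (t % L)) ≡ vertex (suc t)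
      next≡ (inj₁ lt) = cong (at (v ∷ vs) v) (sym (trans suc-% (m<n⇒m%n≡m lt)))
      -- Position `L` is past the end, where the default value of `at` is the starting vertex again.
      next≡ (inj₂ eq) = begin
        at (v ∷ vs) v (suc (t % L))     ≡⟨ cong (at (v ∷ vs) v) eq ⟩
        at (v ∷ vs) v L                 ≡⟨ at-length (v ∷ vs) v ⟩
        at (v ∷ vs) v 0                 ≡⟨ cong (at (v ∷ vs) v) (n%n≡0 L) ⟨
        at (v ∷ vs) v (L % L)           ≡⟨ cong (λ i → at (v ∷ vs) v (i % L)) eq ⟨
        at (v ∷ vs) v (suc (t % L) % L) ≡⟨ cong (at (v ∷ vs) v) suc-% ⟨
        vertex (suc t)                  ∎
        where open ≡-Reasoning

    -- Each edge moves a letter one place to the left, so after `j` edges letter `j` is in front.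
    lookup-vertex : ∀ t j → lookup (vertex t) j ≡ head (vertex (t + toℕ j))
    lookup-vertex t j = go (toℕ j) t j refl
      where
      lookup-zero : ∀ (w : Vec A (suc n)) → lookup w Fin.zero ≡ head w
      lookup-zero (_ ∷ _) = refl
      go : ∀ d t (j : Fin (suc n)) → toℕ j ≡ d → lookup (vertex t) j ≡ head (vertex (t + d))
      go zero    t Fin.zero    eq = trans (lookup-zero (vertex t)) (cong (head ∘ vertex) (sym (ℕ.+-identityʳ t)))
      go (suc d) t (Fin.suc j) eq = begin
        lookup (vertex t) (Fin.suc j)       ≡⟨ vertex-↝ t j ⟩
        lookup (vertex (suc t)) (inject₁ j) ≡⟨ go d (suc t) (inject₁ j) (trans (Fin.toℕ-inject₁ j) (ℕ.suc-injective eq)) ⟩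
        head (vertex (suc t + d))           ≡⟨ cong (head ∘ vertex) (ℕ.+-suc t d) ⟨
        head (vertex (t + suc d))           ∎
        where open ≡-Reasoning

    heads : Vec A L
    heads = tabulate (head ∘ vertex ∘ toℕ)

    window-heads : ∀ t → window heads (suc n) t ≡ List.lookup (v ∷ vs) t
    window-heads t = trans (lookup-ext eq)
      (trans (cong (at (v ∷ vs) v) (m<n⇒m%n≡m (Fin.toℕ<n t))) (at-lookup (v ∷ vs) v t))
      where
      open ≡-Reasoning
      eq : ∀ j → lookup (window heads (suc n) t) j ≡ lookup (vertex (toℕ t)) j
      eq j = begin
        lookup (window heads (suc n) t) j           ≡⟨ Vec.lookup∘tabulate (λ j → lookup heads ((toℕ t + toℕ j) mod L)) j ⟩
        lookup heads ((toℕ t + toℕ j) mod L)        ≡⟨ Vec.lookup∘tabulate (head ∘ vertex ∘ toℕ) ((toℕ t + toℕ j) mod L) ⟩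
        head (vertex (toℕ ((toℕ t + toℕ j) mod L))) ≡⟨ cong (head ∘ vertex) (toℕ-mod (toℕ t + toℕ j) L) ⟩
        head (vertex ((toℕ t + toℕ j) % L))         ≡⟨ cong (head ∘ at (v ∷ vs) v) (m%n%n≡m%n (toℕ t + toℕ j) L) ⟩
        head (vertex (toℕ t + toℕ j))               ≡⟨ lookup-vertex (toℕ t) j ⟨
        lookup (vertex (toℕ t)) j                   ∎

rotate-injective : ∀ {A : Set} {n} i {v w : Vec A n} → rotate i v ≡ rotate i w → v ≡ w
rotate-injective zero    eq = eq
rotate-injective (suc i) eq = rotate-injective i (rotate₁-injective eq)
  where
  rotate₁-injective : ∀ {A : Set} {n} {v w : Vec A n} → rotate₁ v ≡ rotate₁ w → v ≡ w
  rotate₁-injective {v = []}     {[]}     _  = refl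
  rotate₁-injective {v = x ∷ xs} {y ∷ ys} eq with Vec.∷ʳ-injective xs ys eq
  ... | refl , refl = refl

toList-surjective : ∀ {A : Set} {n} (l : List A) → length l ≡ n → ∃ λ (w : Vec A n) → toList w ≡ l
toList-surjective l refl = Vec.fromList l , Vec.toList∘fromList l

-- Closed walks through unions of rotation classes.

module Tours {k n : ℕ} where
  open Oriented {k}
  open Walks {Fin (3 + k)} {n}

  W : Set
  W = Word (3 + k) (suc n)

  -- Closure under rotation ensures that a further rotation class is either contained in the tour or
  -- disjoint from it.
  record Tour : Set where
    field
      start  : W
      rest   : List W
      walk   : Walk start rest start
    vertices : List W
    vertices = start ∷ rest
    field
      unique  : Unique vertices
      closed₁ : ∀ {w} → w ∈ vertices → rotate₁ w ∈ vertices
      within  : ∀ {w} → w ∈ vertices → 𝐒 (3 + k) (suc n) w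

    closed : ∀ {v w} → v ≈ w → v ∈ vertices → w ∈ vertices
    closed {v} (i , refl) v∈ = go i
      where
      go : ∀ i → rotate i v ∈ vertices
      go zero    = v∈
      go (suc i) = closed₁ (go i)

  open Tour

  -- Words may be periodic, so the cycle stops at the least period `suc p`; running through all
  -- `suc n` rotations could repeat vertices.
  orbit : ∀ w → 𝐒 (3 + k) (suc n) w → Σ Tour λ T → start T ≡ w × (∀ {v} → v ∈ vertices T → w ≈ v)
  orbit w w∈𝐒 with least (λ i → Vec.≡-dec Fin._≟_ (rotate (suc i) w) w) n (rotate-full w)
  ... | p , period , minimal = record
    { start   = w
    ; rest    = applyUpTo (f ∘ suc) p
    ; walk    = subst (Walk w _) period (walk-applyUpTo f (λ i → ↝-rotate₁ (f i)) p)
    ; unique  = Unique.applyUpTo⁺₁ f (suc p) distinct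
    ; closed₁ = λ v∈ → let i , i<1+p , eq = ∈.∈-applyUpTo⁻ f v∈ in
        subst (λ v → rotate₁ v ∈ applyUpTo f (suc p)) (sym eq) (next∈ (ℕ.m≤n⇒m<n∨m≡n i<1+p))
    ; within  = λ v∈ → 𝐒-≈ (orbit-≈ v∈) w∈𝐒
    } , refl , orbit-≈
    where
    f : ℕ → W
    f i = rotate i w
    distinct : ∀ {i j} → i < j → j < suc p → f i ≢ f j
    -- Cancelling `rotate i` leaves the period `suc d`, shorter than `suc p`.
    distinct {i} {j} i<j (s≤s j≤p) eq = minimal d<p (rotate-injective i (begin
        rotate i (rotate (suc d) w) ≡⟨ rotate-+ i (suc d) w ⟨
        rotate (i + suc d) w        ≡⟨ cong f (trans (ℕ.+-suc i d) (ℕ.m+[n∸m]≡n i<j)) ⟩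
        rotate j w                  ≡⟨ eq ⟨
        rotate i w                  ∎))
      where
      open ≡-Reasoning
      d = j ∸ suc i
      d<p : d < p
      d<p = ℕ.≤-trans (ℕ.≤-trans (s≤s (ℕ.m≤n+m d i)) (ℕ.≤-reflexive (ℕ.m+[n∸m]≡n i<j))) j≤p
    orbit-≈ : ∀ {v} → v ∈ applyUpTo f (suc p) → w ≈ v
    orbit-≈ v∈ = let i , _ , eq = ∈.∈-applyUpTo⁻ f v∈ in i , sym eq
    next∈ : ∀ {i} → suc i < suc p ⊎ suc i ≡ suc p → f (suc i) ∈ applyUpTo f (suc p)
    next∈ (inj₁ lt)   = ∈.∈-applyUpTo⁺ f lt
    next∈ (inj₂ refl) = here period

  infix 4 _⊑_
  _⊑_ : Tour → Tour → Set
  T ⊑ T′ = vertices T ⊆ vertices T′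

  join : ∀ T {x y α} → x ∷ α ∈ vertices T → 𝐒 (3 + k) (suc n) (y ∷ α) →
    Σ Tour λ T′ → T ⊑ T′ × y ∷ α ∈ vertices T′
  join T {x} {y} {α} xα∈ yα∈𝐒 with Any.any? (Vec.≡-dec Fin._≟_ (y ∷ α)) (vertices T)
  ... | yes yα∈ = T , (λ v∈ → v∈) , yα∈
  ... | no yα∉ with orbit (y ∷ α) yα∈𝐒
  ...   | O , refl , O-≈ with splice (walk O) xα∈ (walk T)
  ...     | us , us-walk , perm = T′ , old , new (here refl)
    where
    old : ∀ {v} → v ∈ vertices T → v ∈ start T ∷ us
    old v∈ = ↭.∈-resp-↭ (↭-sym perm) (∈.∈-++⁺ʳ (vertices O) v∈)
    new : ∀ {v} → v ∈ vertices O → v ∈ start T ∷ us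
    new v∈ = ↭.∈-resp-↭ (↭-sym perm) (∈.∈-++⁺ˡ v∈)
    split : ∀ {v} → v ∈ start T ∷ us → v ∈ vertices O ⊎ v ∈ vertices T
    split v∈ = ∈.∈-++⁻ (vertices O) (↭.∈-resp-↭ perm v∈)
    T′ : Tour
    T′ = record
      { start   = start T
      ; rest    = us
      ; walk    = us-walk
      ; unique  = ↭ₛ.Unique-resp-↭ (setoid W) (↭⇒↭ₛ (↭-sym perm))
          -- A common vertex would, by closure of `T`, bring `y ∷ α` into `T`.
          (Unique.++⁺ (unique O) (unique T) λ (v∈O , v∈T) → yα∉ (closed T (≈-sym (O-≈ v∈O)) v∈T))
      ; closed₁ = λ v∈ → [ new ∘ closed₁ O , old ∘ closed₁ T ]′ (split v∈)
      ; within  = λ v∈ → [ within O , within T ]′ (split v∈)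
      }

  Covers : Tour → Str → Set
  Covers T a = ∃ λ w → w ∈ vertices T × toList w ≡ a

  -- Rotating by `length p` brings the changed letter to the front, so the two words differ only in
  -- their heads and `join` applies; `suc (length s)` further rotations restore the order.
  cover-step : ∀ T {a b} → Step a b → Covers T a → Σ Tour λ T′ → T ⊑ T′ × Covers T′ b
  cover-step T (step {x} {y} p s refl refl _ ob) (w , w∈ , eq)
    with rotate (length p) w in v≡ | toList-rotate w p (x ∷ s) eq | closed T (length p , refl) w∈
  ... | x ∷ α | eq′ | v∈ with List.∷-injective eq′
  ...   | refl , eq″ = T′ , T⊑T′ , w′ , closed T′ yα≈w′ yα∈T′ , w′≡
    where
    w′ = rotate (suc (length s)) (y ∷ α)
    yα≈w′ : y ∷ α ≈ w′
    yα≈w′ = suc (length s) , refl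
    w′≡ : toList w′ ≡ p ++ y ∷ s
    w′≡ = toList-rotate (y ∷ α) (y ∷ s) p (cong (y ∷_) eq″)
    w′∈𝐒 = belowReversals⇒𝐒 w′ (oriented⇒belowReversals w′ (subst Oriented (sym w′≡) ob))
    joined = join T v∈ (𝐒-≈ (≈-sym yα≈w′) w′∈𝐒)
    T′ = proj₁ joined
    T⊑T′ : T ⊑ T′
    T⊑T′ = proj₁ (proj₂ joined)
    yα∈T′ = proj₂ (proj₂ joined)

  cover-steps : ∀ T {a b} → Star Step a b → Covers T a → Σ Tour λ T′ → T ⊑ T′ × Covers T′ b
  cover-steps T ε        c = T , (λ v∈ → v∈) , c
  cover-steps T (s ◅ ss) c with cover-step T s c
  ... | T₁ , T⊑T₁ , c₁ with cover-steps T₁ ss c₁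
  ...   | T₂ , T₁⊑T₂ , c₂ = T₂ , (λ v∈ → T₁⊑T₂ (T⊑T₁ v∈)) , c₂

-- Counting the elements of `𝐒`.

𝐒-list : ∀ k n → List (Word k n)
𝐒-list k n = filter 𝐒? (words k n)

module _ {k n : ℕ} where

  ∈-𝐒-list⁺ : ∀ {w} → 𝐒 k n w → w ∈ 𝐒-list k n
  ∈-𝐒-list⁺ {w} = ∈.∈-filter⁺ 𝐒? (∈-words w)

  ∈-𝐒-list⁻ : ∀ {w} → w ∈ 𝐒-list k n → 𝐒 k n w
  ∈-𝐒-list⁻ w∈ = proj₂ (∈.∈-filter⁻ 𝐒? {xs = words k n} w∈)

  length-𝐒 : ∀ {ws} → Unique ws → (∀ {w} → w ∈ ws → 𝐒 k n w) → (∀ {w} → 𝐒 k n w → w ∈ ws) →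
    length ws ≡ ∣𝐒∣ k n
  length-𝐒 ws-unique ws⊆𝐒 𝐒⊆ws = ℕ.≤-antisym
    (unique-⊆⇒length≤ ws-unique λ w∈ → ∈-𝐒-list⁺ (ws⊆𝐒 w∈))
    (unique-⊆⇒length≤ (Unique.filter⁺ 𝐒? (words-unique k n)) λ w∈ → 𝐒⊆ws (∈-𝐒-list⁻ w∈))

-- The tour through all of `𝐒` and its sequence of letters.

module _ {k n : ℕ} where
  open Oriented {k}
  open Tours {k} {2 + n}
  open Tour
  open Walks {Fin (3 + k)} {2 + n}

  root : Str
  root = 0^ (suc n) ++ 𝟏 ∷ [ top ]

  𝐒∋ : W → Set
  𝐒∋ = 𝐒 (3 + k) (3 + n)

  length-root : ∀ j → length (0^ j ++ 𝟏 ∷ [ top ]) ≡ 2 + j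
  length-root j = trans (List.length-++ (0^ j)) (trans (cong (_+ 2) (List.length-replicate j)) (ℕ.+-comm j 2))

  root-tour : Σ Tour λ T → Covers T root
  root-tour = T , w , here (sym start≡) , w≡
    where
    w : W
    w = proj₁ (toList-surjective root (length-root (suc n)))
    w≡ : toList w ≡ root
    w≡ = proj₂ (toList-surjective root (length-root (suc n)))
    w-oriented : Oriented (toList w)
    w-oriented = subst Oriented (sym w≡) (shortRuns-oriented (suc n) [] (shortRuns-ones n 0))
    w-orbit = orbit w (belowReversals⇒𝐒 w (oriented⇒belowReversals w w-oriented))
    T = proj₁ w-orbit
    start≡ : start T ≡ w
    start≡ = proj₁ (proj₂ w-orbit)

  -- The path found leads from `α` to some `0^ j ++ 𝟏 ∷ [ top ]`. Equality of lengths forces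
  -- `j ≡ suc n`, and steps are reversible.
  𝐀-root : ∀ {α} → 𝐀 (3 + k) (3 + n) α → Star Step root (toList α)
  𝐀-root {α} α∈ with oriented-root (toList α) (subst (3 ≤_) (sym (Vec.length-toList α)) (s≤s (s≤s (s≤s z≤n))))
                                   (belowReversals⇒oriented α (𝐀⇒belowReversals α∈))
  ... | j , ss with ℕ.suc-injective (ℕ.suc-injective (
           trans (sym (length-root j)) (trans (sym (steps-length ss)) (Vec.length-toList α))))
  ...   | refl = Star.reverse step-sym ss

  cover-word : ∀ T {w} → Covers T root → 𝐒∋ w → Σ Tour λ T′ → T ⊑ T′ × w ∈ vertices T′
  cover-word T {w} c (α , α∈ , rot) = T′ , proj₁ (proj₂ covered) , w∈
    where
    covered = cover-steps T (𝐀-root α∈) c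
    T′ = proj₁ covered
    w∈ : w ∈ vertices T′
    w∈ = let _ , α′∈ , α′≡ = proj₂ (proj₂ covered) in
      closed T′ (rotations⇒≈ {α = α} rot) (subst (_∈ vertices T′) (toList-injective α′≡) α′∈)

  cover-all : ∀ T ws → Covers T root → (∀ {w} → w ∈ ws → 𝐒∋ w) → Σ Tour λ T′ → T ⊑ T′ × ws ⊆ vertices T′
  cover-all T []       c                  _    = T , (λ v∈ → v∈) , λ ()
  cover-all T (w ∷ ws) c@(r , r∈ , r≡) ws∈𝐒 =
    let T₁ , T⊑T₁ , w∈    = cover-word T c (ws∈𝐒 (here refl))
        T₂ , T₁⊑T₂ , ws⊆ = cover-all T₁ ws (r , T⊑T₁ r∈ , r≡) (ws∈𝐒 ∘ there)
    in T₂ , (λ v∈ → T₁⊑T₂ (T⊑T₁ v∈)) , λ { (here refl) → T₁⊑T₂ w∈ ; (there v∈) → ws⊆ v∈ }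

  full-tour : Σ Tour λ T → ∀ {w} → 𝐒∋ w → w ∈ vertices T
  full-tour = proj₁ covered , λ w∈𝐒 → proj₂ (proj₂ covered) (∈-𝐒-list⁺ w∈𝐒)
    where
    covered : Σ Tour λ T → proj₁ root-tour ⊑ T × 𝐒-list (3 + k) (3 + n) ⊆ vertices T
    covered = cover-all (proj₁ root-tour) (𝐒-list (3 + k) (3 + n)) (proj₂ root-tour) ∈-𝐒-list⁻

  universalCycle⇒orientable : ∀ {L} (s : Vec (Fin (3 + k)) L) → UniversalCycle 𝐒∋ s → Orientable (3 + n) s
  universalCycle⇒orientable s (∈𝐒 , once) = injective
    where
    w = window s (3 + n)
    w-injective : ∀ {t t′} → w t ≡ w t′ → t ≡ t′
    w-injective {t} {t′} eq with once (w t) (∈𝐒 t)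
    ... | _ , _ , only = trans (sym (only refl)) (only (sym eq))
    mixed : ∀ {t t′} → w t ≢ Vec.reverse (w t′)
    mixed {t} {t′} eq = 𝐒-reverse (∈𝐒 t′) (subst 𝐒∋ eq (∈𝐒 t))
    injective : Orientable (3 + n) s
    injective {inj₁ t} {inj₁ t′} eq = cong inj₁ (w-injective eq)
    injective {inj₁ t} {inj₂ t′} eq = contradiction eq mixed
    injective {inj₂ t} {inj₁ t′} eq = contradiction (sym eq) mixed
    injective {inj₂ t} {inj₂ t′} eq = cong inj₂ (w-injective (Vec.reverse-injective eq))

  tour⇒universalCycle : ∀ T → (∀ {w} → 𝐒∋ w → w ∈ vertices T) → UniversalCycle 𝐒∋ (heads (walk T))
  tour⇒universalCycle T full =
    (λ t → subst 𝐒∋ (sym (window-heads (walk T) t)) (within T (∈.∈-lookup t))) ,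
    λ β β∈ → Any.index (full β∈) ,
      trans (window-heads (walk T) (Any.index (full β∈))) (sym (Any.lookup-index (full β∈))) ,
      λ {t} eq → lookup-injective (unique T)
        (trans (sym (Any.lookup-index (full β∈))) (trans (sym eq) (window-heads (walk T) t)))

  Solution : ℕ → Set
  Solution L = Σ (Vec (Fin (3 + k)) L) λ s → UniversalCycle 𝐒∋ s × Orientable (3 + n) s

  -- With `L` a variable, the length equation is matched by `refl` and no vector has to be
  -- transported.
  tour⇒solution : ∀ {L} T → (∀ {w} → 𝐒∋ w → w ∈ vertices T) → length (vertices T) ≡ L → Solution L
  tour⇒solution T full refl =
    heads (walk T) , tour⇒universalCycle T full ,
    universalCycle⇒orientable (heads (walk T)) (tour⇒universalCycle T full)

  solution : ∀ {L} → (∀ T → (∀ {w} → 𝐒∋ w → w ∈ vertices T) → length (vertices T) ≡ L) → Solution L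
  solution lengths = let T , full = full-tour in tour⇒solution T full (lengths T full)

mainTheorem11 : ∀ (n k : ℕ) → 3 ≤ n → 3 ≤ k →
    Σ (Vec (Fin k) (∣𝐒∣ k n)) λ s → UniversalCycle (𝐒 k n) s × Orientable n s
mainTheorem11 (suc (suc (suc n))) (suc (suc (suc k))) (s≤s (s≤s (s≤s z≤n))) (s≤s (s≤s (s≤s z≤n))) =
  solution {k} {n} {∣𝐒∣ (3 + k) (3 + n)} λ T full →
    length-𝐒 {3 + k} {3 + n} (Tours.Tour.unique T) (Tours.Tour.within T) full
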